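{- Let $M$ be a term of the CCV $\lambda\mu$-calculus and let $[\![M]\!]$ be its CPS translation, computed from an arbitrary syntax-tree representative of $M$ (the representatives may differ in how the equality (E2) is used to bracket $\mu$ and $\mathsf{where}$). If $[\![M]\!]\to^* N$ by $\beta\eta$-reduction in the target calculus, then $M\to^*(N^{ -1})^{\downarrow}$ in the CCV $\lambda\mu$-calculus.
   Context: CCV $\lambda\mu$-calculus. Ordinary variables $x,y,z,\dots$ and continuation variables $k,l,m,\dots$ form disjoint sets. Terms $M$ and jumps $J$ are given by $M ::= x \mid \lambda x.M \mid MM \mid (M\ \mathsf{where}\ x:=M) \mid \mu k.J$ and $J ::= [k]M \mid (J\ \mathsf{where}\ x:=M)$. (Here $(L\ \mathsf{where}\ x:=M)$ is the let-construct $\mathsf{let}\ x=M\ \mathsf{in}\ L$ written body-first.) $\lambda x$ binds $x$ in its body; in $(L\ \mathsf{where}\ x:=M)$ and $(J\ \mathsf{where}\ x:=M)$ the variable $x$ is bound with scope $L$ (resp. $J$) only; $\mu k$ binds $k$. Terms and jumps are identified up to $\alpha$-conversion and up to the congruence generated by: (E1) $(L\ \mathsf{where}\ x:=(M\ \mathsf{where}\ y:=N))=((L\ \mathsf{where}\ x:=M)\ \mathsf{where}\ y:=N)$ if $y$ is not free in $L$; (E2) $((\mu k.J)\ \mathsf{where}\ x:=M)=\mu k.(J\ \mathsf{where}\ x:=M)$ if $k$ is not free in $M$; (E3) $[k](L\ \mathsf{where}\ x:=M)=([k]L\ \mathsf{where}\ x:=M)$. A value $V$ is a variable or a $\lambda$-abstraction;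 other terms are non-values ($N$ below denotes a non-value). Reduction rules ($z$ fresh): (ad$_1$) $NM\to (zM\ \mathsf{where}\ z:=N)$; (ad$_2$) $VN\to (Vz\ \mathsf{where}\ z:=N)$; ($\beta_\lambda$) $(\lambda x.M)V\to (M\ \mathsf{where}\ x:=V)$; ($\beta_{let}$) $(M\ \mathsf{where}\ x:=V)\to M\{V/x\}$; ($\beta_\mu$) $(M\ \mathsf{where}\ x:=\mu k.J)\to \mu k.J\{[k]\square\mapsto[k](M\ \mathsf{where}\ x:=\square)\}$; ($\beta_{jmp}$) $[l]\mu k.J\to J\{l/k\}$; ($\eta_\lambda$) $\lambda x.Vx\to V$ ($x$ not free in $V$); ($\eta_{let}$) $(x\ \mathsf{where}\ x:=M)\to M$; ($\eta_\mu$) $\mu k.[k]M\to M$ ($k$ not free in $M$). Here $J\{[k]\square\mapsto[k](M\ \mathsf{where}\ x:=\square)\}$ replaces, recursively, each subjump $[k]Q$ of $J$ with $k$ free by $[k](M\ \mathsf{where}\ x:=Q)$ (capture-avoiding), and $J\{l/k\}$ replaces each such $[k]Q$ by $[l]Q$. $\to$ is the compatible closure of these rules, $\to^*$ its reflexive-transitive closure. Reduction by $\eta_\mu$ is called vertical; $M^{\downarrow}$ denotes the normal form of $M$ with respect to vertical reductions. Target calculus: a sorted $\lambda$-calculus with ordinary variables $x$ (sort $W$) and continuation variables $k$ (sort $K$): $T::=\lambda k.Q\mid WW$, $Q::=KW\mid TK$, $W::=x\mid\lambda x.T$, $K::=k\mid\lambda x.Q$, with ordinary $\beta\eta$-reduction.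 CPS translation: for a CCV term $M$ and a target continuation $K$, define $\langle M\rangle[K]$ and $\langle J\rangle$ by: $\langle V\rangle[K]=KV^*$; $\langle V_1V_2\rangle[K]=V_1^*V_2^*K$; $\langle VN\rangle[K]=\langle N\rangle[\lambda y.V^*yK]$; $\langle NV\rangle[K]=\langle N\rangle[\lambda x.xV^*K]$; $\langle N_1N_2\rangle[K]=\langle N_1\rangle[\lambda x.\langle N_2\rangle[\lambda y.xyK]]$; $\langle (L\ \mathsf{where}\ x:=M)\rangle[K]=\langle M\rangle[\lambda x.\langle L\rangle[K]]$ (renaming $x$ if it is free in $K$); $\langle\mu k.J\rangle[K]=(\lambda k.\langle J\rangle)K$; $\langle[k]M\rangle=\langle M\rangle[k]$; $\langle (J\ \mathsf{where}\ x:=M)\rangle=\langle M\rangle[\lambda x.\langle J\rangle]$; $x^*=x$; $(\lambda x.M)^*=\lambda x k.\langle M\rangle[k]$; $[\![M]\!]=\lambda k.\langle M\rangle[k]$ (fresh $x,y,k$ where introduced). Inverse translation from the target calculus to CCV: $(\lambda k.Q)^{ -1}=\mu k.Q^{ -1}$; $(W_1W_2)^{ -1}=W_1^{ -1}W_2^{ -1}$; $(KW)^{ -1}=K^{ -1}[W^{ -1}]$; $(TK)^{ -1}=K^{ -1}[T^{ -1}]$; $x^{ -1}=x$; $(\lambda x.T)^{ -1}=\lambda x.T^{ -1}$; $k^{ -1}=[k]\square$; $(\lambda x.Q)^{ -1}=(Q^{ -1}\ \mathsf{where}\ x:=\square)$, where $K^{ -1}$ is a jump with one hole $\square$ and $K^{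 -1}[M]$ fills the hole with $M$. -}

module Defs where

open import Data.Empty using (⊥)
open import Data.Fin using (Fin; zero; suc; lift; _≟_)
open import Data.Nat using (ℕ; suc)
open import Data.Product using (_×_; ∃-syntax)
open import Data.Vec.Functional using (_∷_)
open import Function using (id; _∘_)
open import Level using (0ℓ)
open import Relation.Binary.Core using (Rel)
open import Relation.Binary.Construct.Closure.Equivalence using (EqClosure)
open import Relation.Binary.Construct.Closure.ReflexiveTransitive using (Star)
open import Relation.Binary.Construct.Union using (_∪_)
open import Relation.Binary.Rewriting using (IsNormalForm)
open import Relation.Nullary using (¬_; Dec; yes; no)

private
  variable
    n m n′ m′ : ℕ

-- Both calculi are in well-scoped de Bruijn form (so α-equivalent terms are
-- identical), with one index space per kind of variable: n counts the ordinary
-- variables in scope, m the continuation variables.  A side condition "not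
-- free in M" or "fresh" is expressed by M being a weakening.

------------------------------------------------------------------------
-- CCV λμ-calculus: syntax trees

infix  6 ƛ_ μ_ [_]_
infixl 7 _·_
infixl 5 _where≔_

data Term (n m : ℕ) : Set
data Jump (n m : ℕ) : Set

-- In  L where≔ M  the variable 0 is bound in L and not in M.
data Term n m where
  var      : Fin n → Term n m
  ƛ_       : Term (suc n) m → Term n m
  _·_      : Term n m → Term n m → Term n m
  _where≔_ : Term (suc n) m → Term n m → Term n m
  μ_       : Jump n (suc m) → Term n m

data Jump n m where
  [_]_     : Fin m → Term n m → Jump n m
  _where≔_ : Jump (suc n) m → Term n m → Jump n m

data Value {n m : ℕ} : Term n m → Set where
  var : (x : Fin n) → Value (var x)
  ƛ_  : (M : Term (suc n) m) → Value (ƛ M)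

NonValue : Term n m → Set
NonValue M = ¬ Value M

value? : (M : Term n m) → Dec (Value M)
value? (var x)      = yes (var x)
value? (ƛ M)        = yes (ƛ M)
value? (M · N)      = no λ ()
value? (L where≔ M) = no λ ()
value? (μ J)        = no λ ()

ren  : (Fin n → Fin n′) → (Fin m → Fin m′) → Term n m → Term n′ m′
renᴶ : (Fin n → Fin n′) → (Fin m → Fin m′) → Jump n m → Jump n′ m′

ren ρ κ (var x)      = var (ρ x)
ren ρ κ (ƛ M)        = ƛ ren (lift 1 ρ) κ M
ren ρ κ (M · N)      = ren ρ κ M · ren ρ κ N
ren ρ κ (L where≔ M) = ren (lift 1 ρ) κ L where≔ ren ρ κ M
ren ρ κ (μ J)        = μ renᴶ ρ (lift 1 κ) J

renᴶ ρ κ ([ k ] M)    = [ κ k ] ren ρ κ M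
renᴶ ρ κ (J where≔ M) = renᴶ (lift 1 ρ) κ J where≔ ren ρ κ M

wk : Term n m → Term (suc n) m
wk = ren suc id

wkᵏ : Term n m → Term n (suc m)
wkᵏ = ren id suc

-- Weakening by a variable placed just outside variable 0.
wk₁ : Term (suc n) m → Term (suc (suc n)) m
wk₁ = ren (lift 1 suc) id

sub  : (Fin n → Term n′ m) → Term n m → Term n′ m
subᴶ : (Fin n → Term n′ m) → Jump n m → Jump n′ m

sub σ (var x)      = σ x
sub σ (ƛ M)        = ƛ sub (var zero ∷ wk ∘ σ) M
sub σ (M · N)      = sub σ M · sub σ N
sub σ (L where≔ M) = sub (var zero ∷ wk ∘ σ) L where≔ sub σ M
sub σ (μ J)        = μ subᴶ (wkᵏ ∘ σ) J

subᴶ σ ([ k ] M)    = [ k ] sub σ M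
subᴶ σ (J where≔ M) = subᴶ (var zero ∷ wk ∘ σ) J where≔ sub σ M

-- M{V/x} and J{l/k}, for x and k the variable 0.
_[_/0] : Term (suc n) m → Term n m → Term n m
M [ V /0] = sub (V ∷ var) M

_[_/0]ᵏ : Jump n (suc m) → Fin m → Jump n m
J [ l /0]ᵏ = renᴶ id (l ∷ id) J

-- redirect k M J  is  J{[k]□ ↦ [k](M where x:=□)}, where x is variable 0 of M.
redirect  : Fin m → Term (suc n) m → Term n m → Term n m
redirectᴶ : Fin m → Term (suc n) m → Jump n m → Jump n m

redirect k M (var x)      = var x
redirect k M (ƛ P)        = ƛ redirect k (wk₁ M) P
redirect k M (P · Q)      = redirect k M P · redirect k M Q
redirect k M (L where≔ P) = redirect k (wk₁ M) L where≔ redirect k M P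
redirect k M (μ J)        = μ redirectᴶ (suc k) (wkᵏ M) J

redirectᴶ k M ([ j ] P) with j ≟ k
... | yes _ = [ j ] (M where≔ redirect k M P)
... | no  _ = [ j ] redirect k M P
redirectᴶ k M (J where≔ P) = redirectᴶ k (wk₁ M) J where≔ redirect k M P

------------------------------------------------------------------------
-- Compatible closure of relations R on terms and S on jumps

module Compatible
  (R : ∀ {n m} → Rel (Term n m) 0ℓ)
  (S : ∀ {n m} → Rel (Jump n m) 0ℓ)
  where

  data Step  {n m : ℕ} : Rel (Term n m) 0ℓ
  data Stepᴶ {n m : ℕ} : Rel (Jump n m) 0ℓ

  data Step {n} {m} where
    root   : ∀ {M M′} → R M M′ → Step M M′
    ƛ_     : ∀ {M M′} → Step M M′ → Step (ƛ M) (ƛ M′)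
    appˡ   : ∀ {M M′ N} → Step M M′ → Step (M · N) (M′ · N)
    appʳ   : ∀ {M N N′} → Step N N′ → Step (M · N) (M · N′)
    whereˡ : ∀ {L L′} {M : Term n m} → Step L L′ → Step (L where≔ M) (L′ where≔ M)
    whereʳ : ∀ {L : Term (suc n) m} {M M′} → Step M M′ → Step (L where≔ M) (L where≔ M′)
    μ_     : ∀ {J J′} → Stepᴶ J J′ → Step (μ J) (μ J′)

  data Stepᴶ {n} {m} where
    root   : ∀ {J J′} → S J J′ → Stepᴶ J J′
    jump   : ∀ {k M M′} → Step M M′ → Stepᴶ ([ k ] M) ([ k ] M′)
    whereˡ : ∀ {J J′} {M : Term n m} → Stepᴶ J J′ → Stepᴶ (J where≔ M) (J′ where≔ M)
    whereʳ : ∀ {J : Jump (suc n) m} {M M′} → Step M M′ → Stepᴶ (J where≔ M) (J where≔ M′)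

------------------------------------------------------------------------
-- Identification of syntax trees

data E {n m : ℕ} : Rel (Term n m) 0ℓ where
  E1 : ∀ {L : Term (suc n) m} {M N} →
       E (L where≔ (M where≔ N)) ((wk₁ L where≔ M) where≔ N)
  E2 : ∀ {J : Jump (suc n) (suc m)} {M} →
       E ((μ J) where≔ M) (μ (J where≔ wkᵏ M))

data Eᴶ {n m : ℕ} : Rel (Jump n m) 0ℓ where
  E3 : ∀ {k} {L : Term (suc n) m} {M} →
       Eᴶ ([ k ] (L where≔ M)) (([ k ] L) where≔ M)

infix 4 _≈_

-- A CCV term is a syntax tree modulo this congruence.
_≈_ : Rel (Term n m) 0ℓ
_≈_ = EqClosure (Compatible.Step E Eᴶ)

Modulo≈ : Rel (Term n m) 0ℓ → Rel (Term n m) 0ℓ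
Modulo≈ R M N = ∃[ M′ ] ∃[ N′ ] (M ≈ M′ × R M′ N′ × N′ ≈ N)

------------------------------------------------------------------------
-- Reduction

data Vertical {n m : ℕ} : Rel (Term n m) 0ℓ where
  η-μ : ∀ {M} → Vertical (μ [ zero ] wkᵏ M) M

data Rule {n m : ℕ} : Rel (Term n m) 0ℓ where
  ad₁      : ∀ {N M} → NonValue N → Rule (N · M) (var zero · wk M where≔ N)
  ad₂      : ∀ {V N} → Value V → NonValue N → Rule (V · N) (wk V · var zero where≔ N)
  β-λ      : ∀ {M V} → Value V → Rule ((ƛ M) · V) (M where≔ V)
  β-let    : ∀ {M V} → Value V → Rule (M where≔ V) (M [ V /0])
  β-μ      : ∀ {M J} → Rule (M where≔ μ J) (μ redirectᴶ zero (wkᵏ M) J)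
  η-λ      : ∀ {V} → Value V → Rule (ƛ (wk V · var zero)) V
  η-let    : ∀ {M} → Rule (var zero where≔ M) M
  vertical : ∀ {M M′} → Vertical M M′ → Rule M M′

data Ruleᴶ {n m : ℕ} : Rel (Jump n m) 0ℓ where
  β-jmp : ∀ {l J} → Ruleᴶ ([ l ] (μ J)) (J [ l /0]ᵏ)

infix 4 _⟶_ _⟶*_ _⟶ᵛ_ _⟶ᵛ*_

-- One-step reductions of terms modulo _≈_, and their reflexive-transitive
-- closures (reflexivity is with respect to _≈_).
_⟶_ _⟶*_ _⟶ᵛ_ _⟶ᵛ*_ : Rel (Term n m) 0ℓ
_⟶_   = Modulo≈ (Compatible.Step Rule Ruleᴶ)
_⟶*_  = Star (_≈_ ∪ _⟶_)
_⟶ᵛ_  = Modulo≈ (Compatible.Step Vertical (λ _ _ → ⊥))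
_⟶ᵛ*_ = Star (_≈_ ∪ _⟶ᵛ_)

-- P = M↓, with "the normal form" read as a definite description: P is a
-- normal form of M, and the only one modulo _≈_.
infix 4 _Is_↓
record _Is_↓ (P M : Term n m) : Set where
  field
    reduces : M ⟶ᵛ* P
    normal  : IsNormalForm _⟶ᵛ_ P
    unique  : ∀ {P′} → M ⟶ᵛ* P′ → IsNormalForm _⟶ᵛ_ P′ → P ≈ P′

------------------------------------------------------------------------
-- Target calculus

infix  6 ƛx_ ƛk_
infixl 7 _·ᵂ_ _·ᴷ_ _·ᵀ_

data T (n m : ℕ) : Set
data Q (n m : ℕ) : Set
data W (n m : ℕ) : Set
data K (n m : ℕ) : Set

data T n m where
  ƛk_  : Q n (suc m) → T n m
  _·ᵂ_ : W n m → W n m → T n m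

data Q n m where
  _·ᴷ_ : K n m → W n m → Q n m
  _·ᵀ_ : T n m → K n m → Q n m

data W n m where
  var : Fin n → W n m
  ƛx_ : T (suc n) m → W n m

data K n m where
  var : Fin m → K n m
  ƛx_ : Q (suc n) m → K n m

renT : (Fin n → Fin n′) → (Fin m → Fin m′) → T n m → T n′ m′
renQ : (Fin n → Fin n′) → (Fin m → Fin m′) → Q n m → Q n′ m′
renW : (Fin n → Fin n′) → (Fin m → Fin m′) → W n m → W n′ m′
renK : (Fin n → Fin n′) → (Fin m → Fin m′) → K n m → K n′ m′

renT ρ κ (ƛk q)    = ƛk renQ ρ (lift 1 κ) q
renT ρ κ (v ·ᵂ w)  = renW ρ κ v ·ᵂ renW ρ κ w
renQ ρ κ (c ·ᴷ w)  = renK ρ κ c ·ᴷ renW ρ κ w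
renQ ρ κ (t ·ᵀ c)  = renT ρ κ t ·ᵀ renK ρ κ c
renW ρ κ (var x)   = var (ρ x)
renW ρ κ (ƛx t)    = ƛx renT (lift 1 ρ) κ t
renK ρ κ (var k)   = var (κ k)
renK ρ κ (ƛx q)    = ƛx renQ (lift 1 ρ) κ q

subT : (Fin n → W n′ m′) → (Fin m → K n′ m′) → T n m → T n′ m′
subQ : (Fin n → W n′ m′) → (Fin m → K n′ m′) → Q n m → Q n′ m′
subW : (Fin n → W n′ m′) → (Fin m → K n′ m′) → W n m → W n′ m′
subK : (Fin n → W n′ m′) → (Fin m → K n′ m′) → K n m → K n′ m′

subT σ τ (ƛk q)    = ƛk subQ (renW id suc ∘ σ) (var zero ∷ renK id suc ∘ τ) q
subT σ τ (v ·ᵂ w)  = subW σ τ v ·ᵂ subW σ τ w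
subQ σ τ (c ·ᴷ w)  = subK σ τ c ·ᴷ subW σ τ w
subQ σ τ (t ·ᵀ c)  = subT σ τ t ·ᵀ subK σ τ c
subW σ τ (var x)   = σ x
subW σ τ (ƛx t)    = ƛx subT (var zero ∷ renW suc id ∘ σ) (renK suc id ∘ τ) t
subK σ τ (var k)   = τ k
subK σ τ (ƛx q)    = ƛx subQ (var zero ∷ renW suc id ∘ σ) (renK suc id ∘ τ) q

infix 4 _⟶T_ _⟶Q_ _⟶W_ _⟶K_ _⟶βη*_

data _⟶T_ {n m : ℕ} : Rel (T n m) 0ℓ
data _⟶Q_ {n m : ℕ} : Rel (Q n m) 0ℓ
data _⟶W_ {n m : ℕ} : Rel (W n m) 0ℓ
data _⟶K_ {n m : ℕ} : Rel (K n m) 0ℓ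

data _⟶T_ {n} {m} where
  β    : ∀ {t : T (suc n) m} {w} → (ƛx t) ·ᵂ w ⟶T subT (w ∷ var) var t
  η    : ∀ {t : T n m} → ƛk (renT id suc t ·ᵀ var zero) ⟶T t
  ƛk_  : ∀ {q q′} → q ⟶Q q′ → ƛk q ⟶T ƛk q′
  appˡ : ∀ {v v′ w} → v ⟶W v′ → v ·ᵂ w ⟶T v′ ·ᵂ w
  appʳ : ∀ {v w w′} → w ⟶W w′ → v ·ᵂ w ⟶T v ·ᵂ w′

data _⟶Q_ {n} {m} where
  βx    : ∀ {q : Q (suc n) m} {w} → (ƛx q) ·ᴷ w ⟶Q subQ (w ∷ var) var q
  βk    : ∀ {q : Q n (suc m)} {c} → (ƛk q) ·ᵀ c ⟶Q subQ var (c ∷ var) q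
  appKˡ : ∀ {c c′ w} → c ⟶K c′ → c ·ᴷ w ⟶Q c′ ·ᴷ w
  appKʳ : ∀ {c w w′} → w ⟶W w′ → c ·ᴷ w ⟶Q c ·ᴷ w′
  appTˡ : ∀ {t t′ c} → t ⟶T t′ → t ·ᵀ c ⟶Q t′ ·ᵀ c
  appTʳ : ∀ {t c c′} → c ⟶K c′ → t ·ᵀ c ⟶Q t ·ᵀ c′

data _⟶W_ {n} {m} where
  η   : ∀ {w : W n m} → ƛx (renW suc id w ·ᵂ var zero) ⟶W w
  ƛx_ : ∀ {t t′} → t ⟶T t′ → ƛx t ⟶W ƛx t′

data _⟶K_ {n} {m} where
  η   : ∀ {c : K n m} → ƛx (renK suc id c ·ᴷ var zero) ⟶K c
  ƛx_ : ∀ {q q′} → q ⟶Q q′ → ƛx q ⟶K ƛx q′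

_⟶βη*_ : Rel (T n m) 0ℓ
_⟶βη*_ = Star _⟶T_

------------------------------------------------------------------------
-- CPS translation of syntax trees

-- cps M ρ κ c  is  ⟨M′⟩[c]  for M′ = ren ρ κ M, and similarly for cpsᴶ and
-- star (V*).  Carrying the renaming, instead of weakening M when a fresh
-- variable is introduced, keeps the recursion structural.
cps  : Term n m → (Fin n → Fin n′) → (Fin m → Fin m′) → K n′ m′ → Q n′ m′
cpsᴶ : Jump n m → (Fin n → Fin n′) → (Fin m → Fin m′) → Q n′ m′
star : (V : Term n m) → Value V → (Fin n → Fin n′) → (Fin m → Fin m′) → W n′ m′

cps (var x) ρ κ c = c ·ᴷ star (var x) (var x) ρ κ
cps (ƛ M)   ρ κ c = c ·ᴷ star (ƛ M) (ƛ M) ρ κ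
cps (M · N) ρ κ c with value? M | value? N
... | yes v | yes w = star M v ρ κ ·ᵂ star N w ρ κ ·ᵀ c
... | yes v | no  _ = cps N ρ κ (ƛx (star M v (suc ∘ ρ) κ ·ᵂ var zero ·ᵀ renK suc id c))
... | no  _ | yes w = cps M ρ κ (ƛx (var zero ·ᵂ star N w (suc ∘ ρ) κ ·ᵀ renK suc id c))
... | no  _ | no  _ =
  cps M ρ κ (ƛx cps N (suc ∘ ρ) κ (ƛx (var (suc zero) ·ᵂ var zero ·ᵀ renK suc id (renK suc id c))))
cps (L where≔ M) ρ κ c = cps M ρ κ (ƛx cps L (lift 1 ρ) κ (renK suc id c))
cps (μ J)        ρ κ c = (ƛk cpsᴶ J ρ (lift 1 κ)) ·ᵀ c

cpsᴶ ([ k ] M)    ρ κ = cps M ρ κ (var (κ k))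
cpsᴶ (J where≔ M) ρ κ = cps M ρ κ (ƛx cpsᴶ J (lift 1 ρ) κ)

star (var x) (var .x) ρ κ = var (ρ x)
star (ƛ M)   (ƛ .M)   ρ κ = ƛx ƛk cps M (lift 1 ρ) (suc ∘ κ) (var zero)

⟦_⟧ : Term n m → T n m
⟦ M ⟧ = ƛk cps M id suc (var zero)

------------------------------------------------------------------------
-- Inverse translation

infix 8 _⁻¹ _⁻¹Q _⁻¹W _⁻¹K[_]

_⁻¹     : T n m → Term n m
_⁻¹Q    : Q n m → Jump n m
_⁻¹W    : W n m → Term n m
_⁻¹K[_] : K n m → Term n m → Jump n m

(ƛk q) ⁻¹      = μ (q ⁻¹Q)
(v ·ᵂ w) ⁻¹    = v ⁻¹W · w ⁻¹W
(c ·ᴷ w) ⁻¹Q   = c ⁻¹K[ w ⁻¹W ]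
(t ·ᵀ c) ⁻¹Q   = c ⁻¹K[ t ⁻¹ ]
(var x) ⁻¹W    = var x
(ƛx t) ⁻¹W     = ƛ (t ⁻¹)
(var k) ⁻¹K[ M ] = [ k ] M
(ƛx q) ⁻¹K[ M ]  = q ⁻¹Q where≔ M

{-# OPTIONS --safe #-}
module Submission where

-- Every term M has a canonical form nf M, in which each "where" is floated out
-- of the arguments of "where" and out of μ as far as scoping allows, and each
-- vertical redex is contracted.  It is invariant under ≈ and under vertical
-- reduction, and M reduces vertically to nf M, so nf M is M↓.  Hence it is
-- enough to show M ⟶* nf (⟦M⟧⁻¹) and that a target step t ⟶ t′ gives
-- nf (t⁻¹) ⟶* nf (t′⁻¹).  For the former, ⟦M⟧⁻¹ and the result of performing all
-- ad₁/ad₂ expansions in M have the same canonical form.  For the latter, a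
-- target β-step is simulated by β-rules and an η-step by an η-rule; the delicate
-- point is congruence under μ, since μk.[k]L collapses to L when k is not free
-- in L, and one needs that reductions of a weakened term are weakenings of
-- reductions.

open import Defs
open import Data.Empty using (⊥; ⊥-elim)
open import Data.Fin using (Fin; zero; suc; lift; _≟_)
open import Data.Fin.Properties using (suc-injective)
open import Data.Maybe using (Maybe; just; nothing; map; zipWith; maybe′)
open import Data.Maybe.Properties using (map-id)
open import Data.Nat using (ℕ; suc; _+_; _≤_; _<_)
open import Data.Nat.Properties using (≤-refl; ≤-reflexive; ≤-trans; <-≤-trans; <-irrefl; <⇒≤; n<1+n; +-monoˡ-<; +-monoʳ-<; +-assoc)
open import Data.Product using (∃-syntax; _×_; _,_; proj₁; proj₂)
open import Data.Sum using (inj₁; inj₂)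
open import Data.Vec.Functional using (_∷_)
open import Function using (id; _∘_; flip)
open import Function.Definitions using (Injective)
open import Level using (0ℓ)
import Relation.Binary.Construct.Closure.Equivalence as Eq
open import Relation.Binary.Construct.Closure.ReflexiveTransitive as Star using (Star; ε; _◅_; _◅◅_)
open import Relation.Binary.Construct.Closure.Symmetric using (fwd; bwd)
open import Relation.Binary.Construct.Union using (_∪_)
open import Relation.Binary.Core using (Rel)
open import Relation.Binary.PropositionalEquality using (_≡_; _≢_; _≗_; refl; sym; trans; cong; cong₂; subst; subst₂; isEquivalence; module ≡-Reasoning)
open import Relation.Binary.Rewriting using (IsNormalForm)
open import Relation.Nullary using (yes; no; contradiction)
open Compatible using (root; ƛ_; appˡ; appʳ; whereˡ; whereʳ; μ_; jump)

-- The direction in which a `where` moves is not a free choice. `L where x:=((μk.J) where y:=N)`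
-- becomes `(L where x:=μk.J) where y:=N` by (E1) and `L where x:=μk.(J where y:=N)` by (E2). With
-- (E1) floating outwards and (E2) oriented into μ, these two would have no common form. So (E2) is
-- read from right to left, which carries a side condition, and canonical forms have to compute
-- whether a continuation variable occurs.
--
-- Since `nf` is a function that is constant along ≈ and along vertical steps, uniqueness of normal
-- forms needs no confluence argument, and the comparison with the CPS image becomes propositional
-- equality.
--
-- The price is paid in the simulation: a μ that takes part in a β-μ or β-jmp redex of `t ⁻¹` may
-- have been contracted away in `nf (t ⁻¹)`. In each such case the missing step amounts to at most
-- vertical steps. As a target step on `Q` may change the head label of a jump, canonical jumps get
-- a reduction relation of their own, which turns into one on terms only under μ.

private
  variable
    n m n₁ m₁ n₂ m₂ n₃ m₃ : ℕ

-- Renaming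

lift-id : {f : Fin n → Fin n} → f ≗ id → lift 1 f ≗ id
lift-id h zero    = refl
lift-id h (suc x) = cong suc (h x)

lift-∘ : {f : Fin n₁ → Fin n₂} {g : Fin n → Fin n₁} {h : Fin n → Fin n₂} →
         f ∘ g ≗ h → lift 1 f ∘ lift 1 g ≗ lift 1 h
lift-∘ e zero    = refl
lift-∘ e (suc x) = cong suc (e x)

-- Hypotheses on renamings are pointwise throughout: without function extensionality, `lift 1 id` is
-- only pointwise the identity.
ren-id : {ρ : Fin n → Fin n} {κ : Fin m → Fin m} → ρ ≗ id → κ ≗ id →
         ∀ M → ren ρ κ M ≡ M
renᴶ-id : {ρ : Fin n → Fin n} {κ : Fin m → Fin m} → ρ ≗ id → κ ≗ id →
          ∀ J → renᴶ ρ κ J ≡ J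
ren-id r k (var x)      = cong var (r x)
ren-id r k (ƛ M)        = cong ƛ_ (ren-id (lift-id r) k M)
ren-id r k (M · N)      = cong₂ _·_ (ren-id r k M) (ren-id r k N)
ren-id r k (L where≔ M) = cong₂ _where≔_ (ren-id (lift-id r) k L) (ren-id r k M)
ren-id r k (μ J)        = cong μ_ (renᴶ-id r (lift-id k) J)
renᴶ-id r k ([ j ] M)    = cong₂ [_]_ (k j) (ren-id r k M)
renᴶ-id r k (J where≔ M) = cong₂ _where≔_ (renᴶ-id (lift-id r) k J) (ren-id r k M)

ren-ren : {ρ₂ : Fin n₁ → Fin n₂} {κ₂ : Fin m₁ → Fin m₂} {ρ₁ : Fin n → Fin n₁}
          {κ₁ : Fin m → Fin m₁} {ρ : Fin n → Fin n₂} {κ : Fin m → Fin m₂} →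
          ρ₂ ∘ ρ₁ ≗ ρ → κ₂ ∘ κ₁ ≗ κ → ∀ M → ren ρ₂ κ₂ (ren ρ₁ κ₁ M) ≡ ren ρ κ M
renᴶ-renᴶ : {ρ₂ : Fin n₁ → Fin n₂} {κ₂ : Fin m₁ → Fin m₂} {ρ₁ : Fin n → Fin n₁}
            {κ₁ : Fin m → Fin m₁} {ρ : Fin n → Fin n₂} {κ : Fin m → Fin m₂} →
            ρ₂ ∘ ρ₁ ≗ ρ → κ₂ ∘ κ₁ ≗ κ → ∀ J → renᴶ ρ₂ κ₂ (renᴶ ρ₁ κ₁ J) ≡ renᴶ ρ κ J
ren-ren r k (var x)      = cong var (r x)
ren-ren r k (ƛ M)        = cong ƛ_ (ren-ren (lift-∘ r) k M)
ren-ren r k (M · N)      = cong₂ _·_ (ren-ren r k M) (ren-ren r k N)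
ren-ren r k (L where≔ M) = cong₂ _where≔_ (ren-ren (lift-∘ r) k L) (ren-ren r k M)
ren-ren r k (μ J)        = cong μ_ (renᴶ-renᴶ r (lift-∘ k) J)
renᴶ-renᴶ r k ([ j ] M)    = cong₂ [_]_ (k j) (ren-ren r k M)
renᴶ-renᴶ r k (J where≔ M) = cong₂ _where≔_ (renᴶ-renᴶ (lift-∘ r) k J) (ren-ren r k M)

ren-swap : {ρ₂ : Fin n₁ → Fin n₂} {κ₂ : Fin m₁ → Fin m₂} {ρ₁ : Fin n → Fin n₁}
           {κ₁ : Fin m → Fin m₁} {ρ₄ : Fin n₃ → Fin n₂} {κ₄ : Fin m₃ → Fin m₂}
           {ρ₃ : Fin n → Fin n₃} {κ₃ : Fin m → Fin m₃} →
           ρ₂ ∘ ρ₁ ≗ ρ₄ ∘ ρ₃ → κ₂ ∘ κ₁ ≗ κ₄ ∘ κ₃ →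
           ∀ M → ren ρ₂ κ₂ (ren ρ₁ κ₁ M) ≡ ren ρ₄ κ₄ (ren ρ₃ κ₃ M)
ren-swap r k M = trans (ren-ren r k M) (sym (ren-ren (λ _ → refl) (λ _ → refl) M))

ren-cong : {ρ ρ′ : Fin n → Fin n₁} {κ κ′ : Fin m → Fin m₁} → ρ ≗ ρ′ → κ ≗ κ′ →
           ∀ M → ren ρ κ M ≡ ren ρ′ κ′ M
ren-cong r k M = trans (sym (ren-id (λ _ → refl) (λ _ → refl) _)) (ren-ren r k M)

lift-suc : (ρ : Fin n → Fin n₁) → lift 1 (lift 1 ρ) ∘ lift 1 suc ≗ lift 1 suc ∘ lift 1 ρ
lift-suc ρ zero    = refl
lift-suc ρ (suc x) = refl

wk₁-ren : (ρ : Fin n → Fin n₁) (κ : Fin m → Fin m₁) → ∀ L →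
          ren (lift 1 (lift 1 ρ)) κ (wk₁ L) ≡ wk₁ (ren (lift 1 ρ) κ L)
wk₁-ren ρ κ = ren-swap (lift-suc ρ) (λ _ → refl)

wkᵏ-ren : (ρ : Fin n → Fin n₁) (κ : Fin m → Fin m₁) → ∀ M →
          ren ρ (lift 1 κ) (wkᵏ M) ≡ wkᵏ (ren ρ κ M)
wkᵏ-ren ρ κ = ren-swap (λ _ → refl) (λ _ → refl)

wk-ren : (ρ : Fin n → Fin n₁) (κ : Fin m → Fin m₁) → ∀ M →
         ren (lift 1 ρ) κ (wk M) ≡ wk (ren ρ κ M)
wk-ren ρ κ = ren-swap (λ _ → refl) (λ _ → refl)

-- Partial renaming of continuation variables

map-zipWith : {A B C A′ B′ C′ : Set} {f : A → B → C} {f′ : A′ → B′ → C′}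
              {g : A → A′} {h : B → B′} {i : C → C′} →
              (∀ a b → f′ (g a) (h b) ≡ i (f a b)) →
              ∀ x y → zipWith f′ (map g x) (map h y) ≡ map i (zipWith f x y)
map-zipWith e (just a) (just b) = cong just (e a b)
map-zipWith e (just a) nothing  = refl
map-zipWith e nothing  _        = refl

map-map : {A B B′ C : Set} {f : B → C} {g : A → B} {f′ : B′ → C} {g′ : A → B′} →
          f ∘ g ≗ f′ ∘ g′ → ∀ x → map f (map g x) ≡ map f′ (map g′ x)
map-map e (just a) = cong just (e a)
map-map e nothing  = refl

liftᵖ : (Fin m → Maybe (Fin m₁)) → Fin (suc m) → Maybe (Fin (suc m₁))
liftᵖ p zero    = just zero
liftᵖ p (suc k) = map suc (p k)

-- Decides non-occurrence and returns the strengthened term in one pass. Canonical forms call it at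
-- `unsuc` only; a general partial map `p` is what survives the passage under `μ_`.
str  : (Fin m → Maybe (Fin m₁)) → Term n m → Maybe (Term n m₁)
strᴶ : (Fin m → Maybe (Fin m₁)) → Jump n m → Maybe (Jump n m₁)
str p (var x)      = just (var x)
str p (ƛ M)        = map ƛ_ (str p M)
str p (M · N)      = zipWith _·_ (str p M) (str p N)
str p (L where≔ M) = zipWith _where≔_ (str p L) (str p M)
str p (μ J)        = map μ_ (strᴶ (liftᵖ p) J)
strᴶ p ([ k ] M)    = zipWith [_]_ (p k) (str p M)
strᴶ p (J where≔ M) = zipWith _where≔_ (strᴶ p J) (str p M)

-- One commuting square covers both strengthening a weakened term and strengthening a renamed one.
Square : (Fin m₁ → Maybe (Fin m₃)) → (Fin m → Fin m₁) →
         (Fin m₂ → Fin m₃) → (Fin m → Maybe (Fin m₂)) → Set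
Square p κ κ′ p′ = ∀ k → p (κ k) ≡ map κ′ (p′ k)

liftᵖ-square : {p : Fin m₁ → Maybe (Fin m₃)} {κ : Fin m → Fin m₁}
               {κ′ : Fin m₂ → Fin m₃} {p′ : Fin m → Maybe (Fin m₂)} →
               Square p κ κ′ p′ → Square (liftᵖ p) (lift 1 κ) (lift 1 κ′) (liftᵖ p′)
liftᵖ-square s zero    = refl
liftᵖ-square {p′ = p′} s (suc k) = trans (cong (map suc) (s k)) (map-map (λ _ → refl) (p′ k))

str-ren : {p : Fin m₁ → Maybe (Fin m₃)} {ρ : Fin n → Fin n₁} {κ : Fin m → Fin m₁}
          {κ′ : Fin m₂ → Fin m₃} {p′ : Fin m → Maybe (Fin m₂)} → Square p κ κ′ p′ →
          ∀ M → str p (ren ρ κ M) ≡ map (ren ρ κ′) (str p′ M)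
strᴶ-ren : {p : Fin m₁ → Maybe (Fin m₃)} {ρ : Fin n → Fin n₁} {κ : Fin m → Fin m₁}
           {κ′ : Fin m₂ → Fin m₃} {p′ : Fin m → Maybe (Fin m₂)} → Square p κ κ′ p′ →
           ∀ J → strᴶ p (renᴶ ρ κ J) ≡ map (renᴶ ρ κ′) (strᴶ p′ J)
str-ren s (var x)  = refl
str-ren {p′ = p′} s (ƛ M) =
  trans (cong (map ƛ_) (str-ren s M)) (map-map (λ _ → refl) (str p′ M))
str-ren {p′ = p′} s (M · N) =
  trans (cong₂ (zipWith _·_) (str-ren s M) (str-ren s N))
        (map-zipWith (λ _ _ → refl) (str p′ M) (str p′ N))
str-ren {p′ = p′} s (L where≔ M) =
  trans (cong₂ (zipWith _where≔_) (str-ren s L) (str-ren s M))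
        (map-zipWith (λ _ _ → refl) (str p′ L) (str p′ M))
str-ren {κ′ = κ′} {p′} s (μ J) =
  trans (cong (map μ_) (strᴶ-ren {κ′ = lift 1 κ′} (liftᵖ-square s) J))
        (map-map (λ _ → refl) (strᴶ (liftᵖ p′) J))
strᴶ-ren {p′ = p′} s ([ k ] M) =
  trans (cong₂ (zipWith [_]_) (s k) (str-ren s M))
        (map-zipWith (λ _ _ → refl) (p′ k) (str p′ M))
strᴶ-ren {p′ = p′} s (J where≔ M) =
  trans (cong₂ (zipWith _where≔_) (strᴶ-ren s J) (str-ren s M))
        (map-zipWith (λ _ _ → refl) (strᴶ p′ J) (str p′ M))

liftᵖ-just : {p : Fin m → Maybe (Fin m)} → p ≗ just → liftᵖ p ≗ just
liftᵖ-just h zero    = refl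
liftᵖ-just h (suc k) = cong (map suc) (h k)

str-just  : {p : Fin m → Maybe (Fin m)} → p ≗ just → ∀ (M : Term n m) → str p M ≡ just M
strᴶ-just : {p : Fin m → Maybe (Fin m)} → p ≗ just → ∀ (J : Jump n m) → strᴶ p J ≡ just J
str-just h (var x)      = refl
str-just h (ƛ M)        = cong (map ƛ_) (str-just h M)
str-just h (M · N)      = cong₂ (zipWith _·_) (str-just h M) (str-just h N)
str-just h (L where≔ M) = cong₂ (zipWith _where≔_) (str-just h L) (str-just h M)
str-just h (μ J)        = cong (map μ_) (strᴶ-just (liftᵖ-just h) J)
strᴶ-just h ([ k ] M)    = cong₂ (zipWith [_]_) (h k) (str-just h M)
strᴶ-just h (J where≔ M) = cong₂ (zipWith _where≔_) (strᴶ-just h J) (str-just h M)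

-- Soundness side of `str`: where `p` is defined, `κ` undoes it, so a successful result exhibits the
-- term as a renaming by `κ`.
_Retracts_ : (Fin m → Maybe (Fin m₁)) → (Fin m₁ → Fin m) → Set
p Retracts κ = ∀ {k k₀} → p k ≡ just k₀ → k ≡ κ k₀

liftᵖ-retracts : {p : Fin m → Maybe (Fin m₁)} {κ : Fin m₁ → Fin m} →
                 p Retracts κ → liftᵖ p Retracts lift 1 κ
liftᵖ-retracts r {zero} refl = refl
liftᵖ-retracts {p = p} r {suc k} e with p k in eq
liftᵖ-retracts r {suc k} refl | just k₀ = cong suc (r eq)

str-retracts : {p : Fin m → Maybe (Fin m₁)} {ρ : Fin n → Fin n} {κ : Fin m₁ → Fin m} →
               ρ ≗ id → p Retracts κ →
               ∀ (M : Term n m) {M₀} → str p M ≡ just M₀ → M ≡ ren ρ κ M₀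
strᴶ-retracts : {p : Fin m → Maybe (Fin m₁)} {ρ : Fin n → Fin n} {κ : Fin m₁ → Fin m} →
                ρ ≗ id → p Retracts κ →
                ∀ (J : Jump n m) {J₀} → strᴶ p J ≡ just J₀ → J ≡ renᴶ ρ κ J₀
str-retracts i r (var x) refl = cong var (sym (i x))
str-retracts {p = p} i r (ƛ M) e with str p M in eM
str-retracts i r (ƛ M) refl | just _ = cong ƛ_ (str-retracts (lift-id i) r M eM)
str-retracts {p = p} i r (M · N) e with str p M in eM | str p N in eN
str-retracts i r (M · N) refl | just _ | just _ =
  cong₂ _·_ (str-retracts i r M eM) (str-retracts i r N eN)
str-retracts {p = p} i r (L where≔ M) e with str p L in eL | str p M in eM
str-retracts i r (L where≔ M) refl | just _ | just _ =
  cong₂ _where≔_ (str-retracts (lift-id i) r L eL) (str-retracts i r M eM)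
str-retracts {p = p} i r (μ J) e with strᴶ (liftᵖ p) J in eJ
str-retracts i r (μ J) refl | just _ = cong μ_ (strᴶ-retracts i (liftᵖ-retracts r) J eJ)
strᴶ-retracts {p = p} i r ([ k ] M) e with p k in ek | str p M in eM
strᴶ-retracts i r ([ k ] M) refl | just _ | just _ =
  cong₂ [_]_ (r ek) (str-retracts i r M eM)
strᴶ-retracts {p = p} i r (J where≔ M) e with strᴶ p J in eJ | str p M in eM
strᴶ-retracts i r (J where≔ M) refl | just _ | just _ =
  cong₂ _where≔_ (strᴶ-retracts (lift-id i) r J eJ) (str-retracts i r M eM)

unsuc : Fin (suc m) → Maybe (Fin m)
unsuc zero    = nothing
unsuc (suc k) = just k

str-wkᵏ : (M : Term n m) → str unsuc (wkᵏ M) ≡ just M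
str-wkᵏ M = trans (str-ren {κ′ = id} (λ _ → refl) M)
  (trans (cong (map (ren id id)) (str-just (λ _ → refl) M))
         (cong just (ren-id (λ _ → refl) (λ _ → refl) M)))

str-unsuc-ren : (ρ : Fin n → Fin n₁) (κ : Fin m → Fin m₁) →
                ∀ M → str unsuc (ren ρ (lift 1 κ) M) ≡ map (ren ρ κ) (str unsuc M)
str-unsuc-ren ρ κ = str-ren λ { zero → refl ; (suc k) → refl }

unsuc-just : (M : Term n (suc m)) {M₀ : Term n m} → str unsuc M ≡ just M₀ → M ≡ wkᵏ M₀
unsuc-just = str-retracts (λ _ → refl) (λ { {suc k} refl → refl })

-- Canonical forms

-- L where x:=M, with the wheres of M floated out by (E1).
whr : Term (suc n) m → Term n m → Term n m
whr L (M where≔ N) = whr (wk₁ L) M where≔ N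
whr L M            = L where≔ M

-- μk.[k]M, with the outermost wheres of M floated out by (E2) and (E3) while k is
-- not free in them.
float : Fin (suc m) → Term n (suc m) → Term n m
float k (L where≔ A) = maybe′ (float k L where≔_) (μ [ k ] (L where≔ A)) (str unsuc A)
float k M            = μ [ k ] M

-- Collapse is tested once, before floating: if the bound variable is free in `L where≔ A` but not
-- in `A`, it is free in `L`, so `float` uncovers no new vertical redex.
mu : Fin (suc m) → Term n (suc m) → Term n m
mu zero    M = maybe′ id (float zero M) (str unsuc M)
mu (suc k) M = float (suc k) M

-- By (E3) the label of a jump can pass every `where`, so a canonical jump is a pair of a head label
-- and a term.
nf  : Term n m → Term n m
nfᴶ : Jump n m → Fin m × Term n m
nf (var x)      = var x
nf (ƛ M)        = ƛ nf M
nf (M · N)      = nf M · nf N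
nf (L where≔ M) = whr (nf L) (nf M)
nf (μ J)        = mu (proj₁ (nfᴶ J)) (proj₂ (nfᴶ J))
nfᴶ ([ k ] M)    = k , nf M
nfᴶ (J where≔ M) = proj₁ (nfᴶ J) , whr (proj₂ (nfᴶ J)) (nf M)

mu-wkᵏ : (M : Term n m) → mu zero (wkᵏ M) ≡ M
mu-wkᵏ M rewrite str-wkᵏ M = refl

float-where : ∀ k (L : Term (suc n) (suc m)) (N : Term n m) →
              float k (L where≔ wkᵏ N) ≡ (float k L where≔ N)
float-where k L N rewrite str-wkᵏ N = refl

-- Collapsing and floating agree here: as the bound variable is not free in `wkᵏ N`, the whole body
-- collapses exactly when `L` does.
mu-where : ∀ k (L : Term (suc n) (suc m)) (N : Term n m) →
           mu k (L where≔ wkᵏ N) ≡ (mu k L where≔ N)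
mu-where (suc k) L N = float-where (suc k) L N
mu-where zero    L N rewrite str-wkᵏ N with str unsuc L
... | just L₀ = refl
... | nothing = refl

whr-ren : (ρ : Fin n → Fin n₁) (κ : Fin m → Fin m₁) → ∀ L M →
          ren ρ κ (whr L M) ≡ whr (ren (lift 1 ρ) κ L) (ren ρ κ M)
whr-ren ρ κ L (var x)      = refl
whr-ren ρ κ L (ƛ M)        = refl
whr-ren ρ κ L (M · N)      = refl
whr-ren ρ κ L (M where≔ N) = cong (_where≔ ren ρ κ N)
  (trans (whr-ren (lift 1 ρ) κ (wk₁ L) M)
         (cong (λ L → whr L (ren (lift 1 ρ) κ M)) (wk₁-ren ρ κ L)))
whr-ren ρ κ L (μ J)        = refl

float-ren : (ρ : Fin n → Fin n₁) (κ : Fin m → Fin m₁) → ∀ k M →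
            ren ρ κ (float k M) ≡ float (lift 1 κ k) (ren ρ (lift 1 κ) M)
float-ren ρ κ k (var x)      = refl
float-ren ρ κ k (ƛ M)        = refl
float-ren ρ κ k (M · N)      = refl
float-ren ρ κ k (L where≔ M) rewrite str-unsuc-ren ρ κ M with str unsuc M
... | just M₀ = cong (_where≔ ren ρ κ M₀) (float-ren (lift 1 ρ) κ k L)
... | nothing = refl
float-ren ρ κ k (μ J)        = refl

mu-ren : (ρ : Fin n → Fin n₁) (κ : Fin m → Fin m₁) → ∀ k M →
         ren ρ κ (mu k M) ≡ mu (lift 1 κ k) (ren ρ (lift 1 κ) M)
mu-ren ρ κ (suc k) M = float-ren ρ κ (suc k) M
mu-ren ρ κ zero    M rewrite str-unsuc-ren ρ κ M with str unsuc M
... | just M₀ = refl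
... | nothing = float-ren ρ κ zero M

nf-ren : (ρ : Fin n → Fin n₁) (κ : Fin m → Fin m₁) → ∀ M →
         nf (ren ρ κ M) ≡ ren ρ κ (nf M)
nfᴶ-ren : (ρ : Fin n → Fin n₁) (κ : Fin m → Fin m₁) → ∀ J →
          nfᴶ (renᴶ ρ κ J) ≡ (κ (proj₁ (nfᴶ J)) , ren ρ κ (proj₂ (nfᴶ J)))
nf-ren ρ κ (var x)      = refl
nf-ren ρ κ (ƛ M)        = cong ƛ_ (nf-ren (lift 1 ρ) κ M)
nf-ren ρ κ (M · N)      = cong₂ _·_ (nf-ren ρ κ M) (nf-ren ρ κ N)
nf-ren ρ κ (L where≔ M) =
  trans (cong₂ whr (nf-ren (lift 1 ρ) κ L) (nf-ren ρ κ M)) (sym (whr-ren ρ κ (nf L) (nf M)))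
nf-ren ρ κ (μ J) rewrite nfᴶ-ren ρ (lift 1 κ) J = sym (mu-ren ρ κ (proj₁ (nfᴶ J)) _)
nfᴶ-ren ρ κ ([ k ] M)    = cong (κ k ,_) (nf-ren ρ κ M)
nfᴶ-ren ρ κ (J where≔ M) rewrite nfᴶ-ren (lift 1 ρ) κ J | nf-ren ρ κ M =
  cong (κ (proj₁ (nfᴶ J)) ,_) (sym (whr-ren ρ κ _ (nf M)))

-- (E1) as an equation between canonical forms; `whr-mu` does the same for (E2).
whr-assoc : ∀ (L : Term (suc n) m) M N → whr L (whr M N) ≡ whr (whr (wk₁ L) M) N
whr-assoc L M (var x)      = refl
whr-assoc L M (ƛ N)        = refl
whr-assoc L M (N · N₁)     = refl
whr-assoc L M (N where≔ A) = cong (_where≔ A)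
  (trans (whr-assoc (wk₁ L) (wk₁ M) N) (cong (λ X → whr X N)
    (sym (trans (whr-ren (lift 1 suc) id (wk₁ L) M)
                (cong (λ X → whr X (wk₁ M)) (wk₁-ren suc id L))))))
whr-assoc L M (μ J)        = refl

-- The wheres of `N` pass through `mu` one at a time by `mu-where`, hence the induction on `N`.
whr-mu : ∀ k (L : Term (suc n) (suc m)) N → whr (mu k L) N ≡ mu k (whr L (wkᵏ N))
whr-mu k L (var x)      = sym (mu-where k L (var x))
whr-mu k L (ƛ N)        = sym (mu-where k L (ƛ N))
whr-mu k L (M · N)      = sym (mu-where k L (M · N))
whr-mu k L (N where≔ A) = begin
  whr (wk₁ (mu k L)) N where≔ A
    ≡⟨ cong (λ X → whr X N where≔ A) (mu-ren (lift 1 suc) id k L) ⟩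
  whr (mu (lift 1 id k) (ren (lift 1 suc) (lift 1 id) L)) N where≔ A
    ≡⟨ cong₂ (λ k X → whr (mu k X) N where≔ A) (lift-id (λ _ → refl) k)
             (ren-cong (λ _ → refl) (lift-id (λ _ → refl)) L) ⟩
  whr (mu k (wk₁ L)) N where≔ A
    ≡⟨ cong (_where≔ A) (whr-mu k (wk₁ L) N) ⟩
  mu k (whr (wk₁ L) (wkᵏ N)) where≔ A
    ≡⟨ mu-where k _ A ⟨
  mu k (whr (wk₁ L) (wkᵏ N) where≔ wkᵏ A)
    ≡⟨ cong (λ X → mu k (whr (wk₁ L) X where≔ wkᵏ A))
            (ren-cong (lift-id (λ _ → refl)) (λ _ → refl) N) ⟨
  mu k (whr L (wkᵏ (N where≔ A))) ∎
  where open ≡-Reasoning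
whr-mu k L (μ J)        = sym (mu-where k L (μ J))

-- Reduction to canonical form

infix 4 _≈ᴶ_

Stepᴱ : Rel (Term n m) 0ℓ
Stepᴱ = Compatible.Step E Eᴶ

_≈ᴶ_ : Rel (Jump n m) 0ℓ
_≈ᴶ_ = Eq.EqClosure (Compatible.Stepᴶ E Eᴶ)

≈-sym : {M N : Term n m} → M ≈ N → N ≈ M
≈-sym = Eq.symmetric _

whr-≈ : ∀ (L : Term (suc n) m) M → L where≔ M ≈ whr L M
whr-≈ L (var x)      = ε
whr-≈ L (ƛ M)        = ε
whr-≈ L (M · N)      = ε
whr-≈ L (M where≔ N) = fwd (root E1) ◅ Eq.gmap (_where≔ N) whereˡ (whr-≈ (wk₁ L) M)
whr-≈ L (μ J)        = ε

float-≈ : ∀ k (L : Term n (suc m)) → μ [ k ] L ≈ float k L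
float-≈ k (var x)      = ε
float-≈ k (ƛ L)        = ε
float-≈ k (L · M)      = ε
float-≈ k (L where≔ A) with str unsuc A in eq
... | nothing = ε
... | just A₀ rewrite unsuc-just A eq =
  fwd (μ root E3) ◅ bwd (root E2) ◅ Eq.gmap (_where≔ A₀) whereˡ (float-≈ k L)
float-≈ k (μ J)        = ε

-- The case split behind every later argument about `mu`. In `keep` a μ survives, but only up to ≈,
-- since wheres may have floated out of it.
data MuView {n m} : Fin (suc m) → Term n (suc m) → Set where
  collapse : ∀ X → MuView zero (wkᵏ X)
  keep     : ∀ {k L} → mu k L ≈ μ [ k ] L → MuView k L

mu-view : ∀ k (L : Term n (suc m)) → MuView k L
mu-view (suc k) L = keep (≈-sym (float-≈ (suc k) L))
mu-view zero L with str unsuc L in eq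
... | just L₀ rewrite unsuc-just L eq = collapse L₀
... | nothing = keep (subst (_≈ μ [ zero ] L) (cong (maybe′ id (float zero L)) (sym eq))
                            (≈-sym (float-≈ zero L)))

module _ {R : ∀ {n m} → Rel (Term n m) 0ℓ} {S : ∀ {n m} → Rel (Jump n m) 0ℓ} where

  -- Its instances are definitionally `_⟶ᵛ*_` and `_⟶*_`, so the congruence lemmas serve both.
  Reduces : Rel (Term n m) 0ℓ
  Reduces = Star (_≈_ ∪ Modulo≈ (Compatible.Step R S))

  reduces-≈ : {M N : Term n m} → M ≈ N → Reduces M N
  reduces-≈ e = inj₁ e ◅ ε

  reduces-step : {M N : Term n m} → Compatible.Step R S M N → Reduces M N
  reduces-step s = inj₂ (_ , _ , ε , s , ε) ◅ ε

  reduces-gmap : (f : Term n m → Term n₁ m₁) →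
                 (∀ {M N} → Stepᴱ M N → Stepᴱ (f M) (f N)) →
                 (∀ {M N} → Compatible.Step R S M N → Compatible.Step R S (f M) (f N)) →
                 ∀ {M N} → Reduces M N → Reduces (f M) (f N)
  reduces-gmap f fᴱ fᴿ = Star.gmap f λ where
    (inj₁ e)                       → inj₁ (Eq.gmap f fᴱ e)
    (inj₂ (_ , _ , e₁ , s , e₂)) → inj₂ (_ , _ , Eq.gmap f fᴱ e₁ , fᴿ s , Eq.gmap f fᴱ e₂)

  reduces-app : {M M′ N N′ : Term n m} → Reduces M M′ → Reduces N N′ → Reduces (M · N) (M′ · N′)
  reduces-app r s = reduces-gmap (_· _) appˡ appˡ r ◅◅ reduces-gmap (_ ·_) appʳ appʳ s

  reduces-where : {L L′ : Term (suc n) m} {M M′ : Term n m} →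
                  Reduces L L′ → Reduces M M′ → Reduces (L where≔ M) (L′ where≔ M′)
  reduces-where r s =
    reduces-gmap (_where≔ _) whereˡ whereˡ r ◅◅ reduces-gmap (_ where≔_) whereʳ whereʳ s

  reduces-whr : {L L′ : Term (suc n) m} {M M′ : Term n m} →
                Reduces L L′ → Reduces M M′ → Reduces (whr L M) (whr L′ M′)
  reduces-whr {L = L} {L′} {M} {M′} r s =
    reduces-≈ (≈-sym (whr-≈ L M)) ◅◅ reduces-where r s ◅◅ reduces-≈ (whr-≈ L′ M′)

  reduces-jump : ∀ k {M N : Term n (suc m)} → Reduces M N → Reduces (μ [ k ] M) (μ [ k ] N)
  reduces-jump k = reduces-gmap (λ M → μ [ k ] M) (λ s → μ jump s) (λ s → μ jump s)

  module Invariance (R-nf : ∀ {n m} {M N : Term n m} → R M N → nf M ≡ nf N)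
                    (S-nf : ∀ {n m} {I J : Jump n m} → S I J → nfᴶ I ≡ nfᴶ J) where
    step-nf  : {M N : Term n m} → Compatible.Step R S M N → nf M ≡ nf N
    stepᴶ-nf : {I J : Jump n m} → Compatible.Stepᴶ R S I J → nfᴶ I ≡ nfᴶ J
    step-nf (root r)             = R-nf r
    step-nf (ƛ s)                = cong ƛ_ (step-nf s)
    step-nf (appˡ {N = N} s)     = cong (_· nf N) (step-nf s)
    step-nf (appʳ {M = M} s)     = cong (nf M ·_) (step-nf s)
    step-nf (whereˡ {M = M} s)   = cong (λ L → whr L (nf M)) (step-nf s)
    step-nf (whereʳ {L = L} s)   = cong (whr (nf L)) (step-nf s)
    step-nf (μ s)                = cong (λ (k , L) → mu k L) (stepᴶ-nf s)
    stepᴶ-nf (root r)            = S-nf r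
    stepᴶ-nf (jump {k = k} s)    = cong (k ,_) (step-nf s)
    stepᴶ-nf (whereˡ {M = M} s)  = cong (λ (k , L) → k , whr L (nf M)) (stepᴶ-nf s)
    stepᴶ-nf (whereʳ {J = J} s)  = cong (λ M → proj₁ (nfᴶ J) , whr (proj₂ (nfᴶ J)) M) (step-nf s)

E-nf : {M N : Term n m} → E M N → nf M ≡ nf N
E-nf (E1 {L} {M} {N}) rewrite nf-ren (lift 1 suc) id L = whr-assoc (nf L) (nf M) (nf N)
E-nf (E2 {J} {M})     rewrite nf-ren id suc M = whr-mu (proj₁ (nfᴶ J)) (proj₂ (nfᴶ J)) (nf M)

Eᴶ-nf : {I J : Jump n m} → Eᴶ I J → nfᴶ I ≡ nfᴶ J
Eᴶ-nf E3 = refl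

Vertical-nf : {M N : Term n m} → Vertical M N → nf M ≡ nf N
Vertical-nf (η-μ {M}) rewrite nf-ren id suc M = mu-wkᵏ (nf M)

≈-nf : {M N : Term n m} → M ≈ N → nf M ≡ nf N
≈-nf = Eq.gfold isEquivalence nf (Invariance.step-nf E-nf Eᴶ-nf)

⟶ᵛ-nf : {M N : Term n m} → M ⟶ᵛ N → nf M ≡ nf N
⟶ᵛ-nf (_ , _ , e₁ , s , e₂) =
  trans (≈-nf e₁) (trans (Invariance.step-nf Vertical-nf (λ ()) s) (≈-nf e₂))

⟶ᵛ*-nf : {M N : Term n m} → M ⟶ᵛ* N → nf M ≡ nf N
⟶ᵛ*-nf ε            = refl
⟶ᵛ*-nf (inj₁ e ◅ r) = trans (≈-nf e) (⟶ᵛ*-nf r)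
⟶ᵛ*-nf (inj₂ s ◅ r) = trans (⟶ᵛ-nf s) (⟶ᵛ*-nf r)

mu-reduces : ∀ k (L : Term n (suc m)) → μ [ k ] L ⟶ᵛ* mu k L
mu-reduces k L with mu-view k L
... | keep e     = reduces-≈ (≈-sym e)
... | collapse X rewrite mu-wkᵏ X = reduces-step (root η-μ)

-- Reduction modulo ≈ is available for terms only, so a jump is treated through this term, which is
-- the jump with its head label stripped by (E3).
body : Jump n m → Term n m
body ([ k ] M)    = M
body (J where≔ M) = body J where≔ M

≈ᴶ-body : (J : Jump n m) → J ≈ᴶ [ proj₁ (nfᴶ J) ] body J
≈ᴶ-body ([ k ] M)    = ε
≈ᴶ-body (J where≔ M) = Eq.gmap (_where≔ M) whereˡ (≈ᴶ-body J) ◅◅ bwd (root E3) ◅ ε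

nf-reduces   : (M : Term n m) → M ⟶ᵛ* nf M
body-reduces : (J : Jump n m) → body J ⟶ᵛ* proj₂ (nfᴶ J)
nf-reduces (var x)      = ε
nf-reduces (ƛ M)        = reduces-gmap ƛ_ ƛ_ ƛ_ (nf-reduces M)
nf-reduces (M · N)      = reduces-app (nf-reduces M) (nf-reduces N)
nf-reduces (L where≔ M) =
  reduces-where (nf-reduces L) (nf-reduces M) ◅◅ reduces-≈ (whr-≈ (nf L) (nf M))
nf-reduces (μ J)        =
  reduces-≈ (Eq.gmap μ_ μ_ (≈ᴶ-body J)) ◅◅ reduces-jump _ (body-reduces J) ◅◅ mu-reduces _ _
body-reduces ([ k ] M)    = nf-reduces M
body-reduces (J where≔ M) =
  reduces-where (body-reduces J) (nf-reduces M) ◅◅ reduces-≈ (whr-≈ _ (nf M))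

-- Vertical normal forms, by counting μ

#μ  : Term n m → ℕ
#μᴶ : Jump n m → ℕ
#μ (var x)      = 0
#μ (ƛ M)        = #μ M
#μ (M · N)      = #μ M + #μ N
#μ (L where≔ M) = #μ L + #μ M
#μ (μ J)        = suc (#μᴶ J)
#μᴶ ([ k ] M)    = #μ M
#μᴶ (J where≔ M) = #μᴶ J + #μ M

#μ-ren  : (ρ : Fin n → Fin n₁) (κ : Fin m → Fin m₁) → ∀ M → #μ (ren ρ κ M) ≡ #μ M
#μᴶ-ren : (ρ : Fin n → Fin n₁) (κ : Fin m → Fin m₁) → ∀ J → #μᴶ (renᴶ ρ κ J) ≡ #μᴶ J
#μ-ren ρ κ (var x)      = refl
#μ-ren ρ κ (ƛ M)        = #μ-ren _ κ M
#μ-ren ρ κ (M · N)      = cong₂ _+_ (#μ-ren ρ κ M) (#μ-ren ρ κ N)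
#μ-ren ρ κ (L where≔ M) = cong₂ _+_ (#μ-ren _ κ L) (#μ-ren ρ κ M)
#μ-ren ρ κ (μ J)        = cong suc (#μᴶ-ren ρ _ J)
#μᴶ-ren ρ κ ([ k ] M)    = #μ-ren ρ κ M
#μᴶ-ren ρ κ (J where≔ M) = cong₂ _+_ (#μᴶ-ren _ κ J) (#μ-ren ρ κ M)

-- (E1)-(E3) neither copy nor erase a subterm, so the count belongs to the ≈-class, while each
-- vertical step lowers it.
#μ-Stepᴱ  : {M N : Term n m} → Stepᴱ M N → #μ M ≡ #μ N
#μᴶ-Stepᴱ : {I J : Jump n m} → Compatible.Stepᴶ E Eᴶ I J → #μᴶ I ≡ #μᴶ J
#μ-Stepᴱ (root (E1 {L} {M} {N})) rewrite #μ-ren (lift 1 suc) id L = sym (+-assoc (#μ L) (#μ M) (#μ N))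
#μ-Stepᴱ (root (E2 {J} {M}))     rewrite #μ-ren id suc M = refl
#μ-Stepᴱ (ƛ s)                   = #μ-Stepᴱ s
#μ-Stepᴱ (appˡ s)                = cong (_+ _) (#μ-Stepᴱ s)
#μ-Stepᴱ (appʳ {M = M} s)        = cong (#μ M +_) (#μ-Stepᴱ s)
#μ-Stepᴱ (whereˡ s)              = cong (_+ _) (#μ-Stepᴱ s)
#μ-Stepᴱ (whereʳ {L = L} s)      = cong (#μ L +_) (#μ-Stepᴱ s)
#μ-Stepᴱ (μ s)                   = cong suc (#μᴶ-Stepᴱ s)
#μᴶ-Stepᴱ (root E3)              = refl
#μᴶ-Stepᴱ (jump s)               = #μ-Stepᴱ s
#μᴶ-Stepᴱ (whereˡ s)             = cong (_+ _) (#μᴶ-Stepᴱ s)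
#μᴶ-Stepᴱ (whereʳ {J = J} s)     = cong (#μᴶ J +_) (#μ-Stepᴱ s)

#μ-Stepᵛ  : {M N : Term n m} → Compatible.Step Vertical (λ _ _ → ⊥) M N → #μ N < #μ M
#μᴶ-Stepᵛ : {I J : Jump n m} → Compatible.Stepᴶ Vertical (λ _ _ → ⊥) I J → #μᴶ J < #μᴶ I
#μ-Stepᵛ (root (η-μ {M}))     rewrite #μ-ren id suc M = n<1+n (#μ M)
#μ-Stepᵛ (ƛ s)                = #μ-Stepᵛ s
#μ-Stepᵛ (appˡ s)             = +-monoˡ-< _ (#μ-Stepᵛ s)
#μ-Stepᵛ (appʳ {M = M} s)     = +-monoʳ-< (#μ M) (#μ-Stepᵛ s)
#μ-Stepᵛ (whereˡ s)           = +-monoˡ-< _ (#μ-Stepᵛ s)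
#μ-Stepᵛ (whereʳ {L = L} s)   = +-monoʳ-< (#μ L) (#μ-Stepᵛ s)
#μ-Stepᵛ (μ s)                = +-monoʳ-< 1 (#μᴶ-Stepᵛ s)
#μᴶ-Stepᵛ (jump s)            = #μ-Stepᵛ s
#μᴶ-Stepᵛ (whereˡ s)          = +-monoˡ-< _ (#μᴶ-Stepᵛ s)
#μᴶ-Stepᵛ (whereʳ {J = J} s)  = +-monoʳ-< (#μᴶ J) (#μ-Stepᵛ s)

#μ-≈ : {M N : Term n m} → M ≈ N → #μ M ≡ #μ N
#μ-≈ = Eq.gfold isEquivalence #μ #μ-Stepᴱ

#μ-⟶ᵛ : {M N : Term n m} → M ⟶ᵛ N → #μ N < #μ M
#μ-⟶ᵛ (_ , _ , e₁ , s , e₂) = subst₂ _<_ (#μ-≈ e₂) (sym (#μ-≈ e₁)) (#μ-Stepᵛ s)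

#μ-⟶ᵛ* : {M N : Term n m} → M ⟶ᵛ* N → #μ N ≤ #μ M
#μ-⟶ᵛ* ε            = ≤-refl
#μ-⟶ᵛ* (inj₁ e ◅ r) = ≤-trans (#μ-⟶ᵛ* r) (≤-reflexive (sym (#μ-≈ e)))
#μ-⟶ᵛ* (inj₂ s ◅ r) = ≤-trans (#μ-⟶ᵛ* r) (<⇒≤ (#μ-⟶ᵛ s))

-- A vertical step from nf M to N would give #μ N < #μ (nf M) = #μ (nf N) ≤ #μ N.
nf-normal : (M : Term n m) → IsNormalForm _⟶ᵛ_ (nf M)
nf-normal M (N , s) = <-irrefl refl (<-≤-trans (#μ-⟶ᵛ s) #nf≤#N)
  where
  nf-N : nf N ≡ nf M
  nf-N = sym (trans (⟶ᵛ*-nf (nf-reduces M)) (⟶ᵛ-nf s))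
  #nf≤#N : #μ (nf M) ≤ #μ N
  #nf≤#N = subst (λ X → #μ X ≤ #μ N) nf-N (#μ-⟶ᵛ* (nf-reduces N))

normal-≈ : {M N : Term n m} → IsNormalForm _⟶ᵛ_ M → M ⟶ᵛ* N → M ≈ N
normal-≈ nf ε            = ε
normal-≈ nf (inj₁ e ◅ r) =
  e ◅◅ normal-≈ (λ { (_ , _ , _ , e₁ , s) → nf (_ , _ , _ , e ◅◅ e₁ , s) }) r
normal-≈ nf (inj₂ s ◅ r) = ⊥-elim (nf (_ , s))

nf-Is-↓ : (M : Term n m) → nf M Is M ↓
nf-Is-↓ M = record
  { reduces = nf-reduces M
  ; normal  = nf-normal M
  -- A normal `P′` reaches `nf P′` by ≈ alone, and `nf P′` is `nf M` by invariance.
  ; unique  = λ {P′} r nf-P′ → ≈-sym (subst (P′ ≈_) (sym (⟶ᵛ*-nf r)) (normal-≈ nf-P′ (nf-reduces P′)))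
  }

-- Substitution

value-ren : {ρ : Fin n → Fin n₁} {κ : Fin m → Fin m₁} {V : Term n m} → Value V → Value (ren ρ κ V)
value-ren (var x) = var _
value-ren (ƛ M)   = ƛ _

value-ren⁻ : {ρ : Fin n → Fin n₁} {κ : Fin m → Fin m₁} (V : Term n m) → Value (ren ρ κ V) → Value V
value-ren⁻ (var x) _ = var x
value-ren⁻ (ƛ M)   _ = ƛ M

-- The pointwise square is general enough for naturality, for `sub-cong`, and, with `σ = var`, for
-- cancelling a weakening.
sub-ren : {σ : Fin n → Term n₁ m} {ρ : Fin n₁ → Fin n₂} {κ : Fin m → Fin m₁}
          {τ : Fin n₃ → Term n₂ m₁} {ρ′ : Fin n → Fin n₃} →
          (∀ x → τ (ρ′ x) ≡ ren ρ κ (σ x)) →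
          ∀ M → sub τ (ren ρ′ κ M) ≡ ren ρ κ (sub σ M)
subᴶ-ren : {σ : Fin n → Term n₁ m} {ρ : Fin n₁ → Fin n₂} {κ : Fin m → Fin m₁}
           {τ : Fin n₃ → Term n₂ m₁} {ρ′ : Fin n → Fin n₃} →
           (∀ x → τ (ρ′ x) ≡ ren ρ κ (σ x)) →
           ∀ J → subᴶ τ (renᴶ ρ′ κ J) ≡ renᴶ ρ κ (subᴶ σ J)

sub-ren-lift : {σ : Fin n → Term n₁ m} {ρ : Fin n₁ → Fin n₂} {κ : Fin m → Fin m₁}
               {τ : Fin n₃ → Term n₂ m₁} {ρ′ : Fin n → Fin n₃} →
               (∀ x → τ (ρ′ x) ≡ ren ρ κ (σ x)) →
               ∀ x → (var zero ∷ wk ∘ τ) (lift 1 ρ′ x) ≡ ren (lift 1 ρ) κ ((var zero ∷ wk ∘ σ) x)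
sub-ren-lift h zero = refl
sub-ren-lift {σ = σ} {ρ} {κ} h (suc x) = trans (cong wk (h x)) (sym (wk-ren ρ κ (σ x)))

sub-ren h (var x)      = h x
sub-ren h (ƛ M)        = cong ƛ_ (sub-ren (sub-ren-lift h) M)
sub-ren h (M · N)      = cong₂ _·_ (sub-ren h M) (sub-ren h N)
sub-ren h (L where≔ M) = cong₂ _where≔_ (sub-ren (sub-ren-lift h) L) (sub-ren h M)
sub-ren {σ = σ} {ρ} {κ} h (μ J) =
  cong μ_ (subᴶ-ren (λ x → trans (cong wkᵏ (h x)) (sym (wkᵏ-ren ρ κ (σ x)))) J)
subᴶ-ren h ([ k ] M)    = cong ([ _ ]_) (sub-ren h M)
subᴶ-ren h (J where≔ M) = cong₂ _where≔_ (subᴶ-ren (sub-ren-lift h) J) (sub-ren h M)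

sub-var  : {σ : Fin n → Term n m} → σ ≗ var → ∀ M → sub σ M ≡ M
subᴶ-var : {σ : Fin n → Term n m} → σ ≗ var → ∀ J → subᴶ σ J ≡ J

sub-var-lift : {σ : Fin n → Term n m} → σ ≗ var → (var zero ∷ wk ∘ σ) ≗ var
sub-var-lift h zero    = refl
sub-var-lift h (suc x) = cong wk (h x)

sub-var h (var x)      = h x
sub-var h (ƛ M)        = cong ƛ_ (sub-var (sub-var-lift h) M)
sub-var h (M · N)      = cong₂ _·_ (sub-var h M) (sub-var h N)
sub-var h (L where≔ M) = cong₂ _where≔_ (sub-var (sub-var-lift h) L) (sub-var h M)
sub-var h (μ J)        = cong μ_ (subᴶ-var (λ x → cong wkᵏ (h x)) J)
subᴶ-var h ([ k ] M)    = cong ([ k ]_) (sub-var h M)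
subᴶ-var h (J where≔ M) = cong₂ _where≔_ (subᴶ-var (sub-var-lift h) J) (sub-var h M)

str-sub : {p : Fin m → Maybe (Fin m₁)} {σ : Fin n → Term n₁ m} {τ : Fin n → Term n₁ m₁} →
          (∀ x → str p (σ x) ≡ just (τ x)) → ∀ M → str p (sub σ M) ≡ map (sub τ) (str p M)
strᴶ-sub : {p : Fin m → Maybe (Fin m₁)} {σ : Fin n → Term n₁ m} {τ : Fin n → Term n₁ m₁} →
           (∀ x → str p (σ x) ≡ just (τ x)) → ∀ J → strᴶ p (subᴶ σ J) ≡ map (subᴶ τ) (strᴶ p J)

str-sub-lift : {p : Fin m → Maybe (Fin m₁)} {σ : Fin n → Term n₁ m} {τ : Fin n → Term n₁ m₁} →
               (∀ x → str p (σ x) ≡ just (τ x)) →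
               ∀ x → str p ((var zero ∷ wk ∘ σ) x) ≡ just ((var zero ∷ wk ∘ τ) x)
str-sub-lift h zero = refl
str-sub-lift {p = p} {σ} h (suc x) =
  trans (str-ren {κ′ = id} (λ k → sym (map-id (p k))) (σ x)) (cong (map wk) (h x))

str-sub h (var x) = h x
str-sub {p = p} h (ƛ M) =
  trans (cong (map ƛ_) (str-sub (str-sub-lift h) M)) (map-map (λ _ → refl) (str p M))
str-sub {p = p} h (M · N) =
  trans (cong₂ (zipWith _·_) (str-sub h M) (str-sub h N))
        (map-zipWith (λ _ _ → refl) (str p M) (str p N))
str-sub {p = p} h (L where≔ M) =
  trans (cong₂ (zipWith _where≔_) (str-sub (str-sub-lift h) L) (str-sub h M))
        (map-zipWith (λ _ _ → refl) (str p L) (str p M))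
str-sub {p = p} {σ} h (μ J) =
  trans (cong (map μ_) (strᴶ-sub (λ x → trans (str-ren {κ′ = suc} (λ _ → refl) (σ x))
                                              (cong (map wkᵏ) (h x))) J))
        (map-map (λ _ → refl) (strᴶ (liftᵖ p) J))
strᴶ-sub {p = p} h ([ k ] M) =
  trans (cong₂ (zipWith [_]_) (sym (map-id (p k))) (str-sub h M))
        (map-zipWith (λ _ _ → refl) (p k) (str p M))
strᴶ-sub {p = p} h (J where≔ M) =
  trans (cong₂ (zipWith _where≔_) (strᴶ-sub (str-sub-lift h) J) (str-sub h M))
        (map-zipWith (λ _ _ → refl) (strᴶ p J) (str p M))

-- Canonical forms commute with substitution of values only: a `where` substituted for `x` in
-- `L where≔ var x` would still have to be floated out.
Values : (Fin n → Term n₁ m) → Set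
Values σ = ∀ x → Value (σ x)

values-lift : {σ : Fin n → Term n₁ m} → Values σ → Values (var zero ∷ wk ∘ σ)
values-lift v zero    = var zero
values-lift v (suc x) = value-ren (v x)

whr-value : ∀ (L : Term (suc n) m) {V} → Value V → whr L V ≡ (L where≔ V)
whr-value L (var x) = refl
whr-value L (ƛ M)   = refl

float-value : ∀ k {V : Term n (suc m)} → Value V → float k V ≡ μ [ k ] V
float-value k (var x) = refl
float-value k (ƛ M)   = refl

sub-whr : {σ : Fin n → Term n₁ m} → Values σ → ∀ L M →
          sub σ (whr L M) ≡ whr (sub (var zero ∷ wk ∘ σ) L) (sub σ M)
sub-whr v L (var x)      = sym (whr-value _ (v x))
sub-whr v L (ƛ M)        = refl
sub-whr v L (M · N)      = refl
sub-whr {σ = σ} v L (M where≔ N) = cong (_where≔ sub σ N)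
  (trans (sub-whr (values-lift v) (wk₁ L) M)
         (cong (λ L → whr L _) (sub-ren (λ { zero → refl ; (suc x) → sym (wk-suc x) }) L)))
  where
  wk-suc : ∀ x → wk₁ (wk (σ x)) ≡ wk (wk (σ x))
  wk-suc x = wk-ren suc id (σ x)
sub-whr v L (μ J)        = refl

str-unsuc-sub : (σ : Fin n → Term n₁ m) → ∀ M →
                str unsuc (sub (wkᵏ ∘ σ) M) ≡ map (sub σ) (str unsuc M)
str-unsuc-sub σ = str-sub (λ x → str-wkᵏ (σ x))

sub-cong : {σ τ : Fin n → Term n₁ m} → σ ≗ τ → ∀ M → sub σ M ≡ sub τ M
sub-cong {σ = σ} {τ} h M = trans
  (cong (sub σ) (sym (ren-id (λ _ → refl) (λ _ → refl) M)))
  (trans (sub-ren (λ x → trans (h x) (sym (ren-id (λ _ → refl) (λ _ → refl) (τ x)))) M)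
         (ren-id (λ _ → refl) (λ _ → refl) (sub τ M)))

sub-float : {σ : Fin n → Term n₁ m} → Values σ → ∀ k M →
            sub σ (float k M) ≡ float k (sub (wkᵏ ∘ σ) M)
sub-float v k (var x)      = sym (float-value k (value-ren (v x)))
sub-float v k (ƛ M)        = refl
sub-float v k (M · N)      = refl
sub-float {σ = σ} v k (L where≔ M) rewrite str-unsuc-sub σ M with str unsuc M
... | just M₀ = cong (_where≔ sub σ M₀)
  (trans (sub-float (values-lift v) k L) (cong (float k)
    (sub-cong (λ { zero → refl ; (suc x) → ren-swap (λ _ → refl) (λ _ → refl) (σ x) }) L)))
... | nothing = refl
sub-float v k (μ J)        = refl

sub-mu : {σ : Fin n → Term n₁ m} → Values σ → ∀ k M → sub σ (mu k M) ≡ mu k (sub (wkᵏ ∘ σ) M)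
sub-mu v (suc k) M = sub-float v (suc k) M
sub-mu {σ = σ} v zero M rewrite str-unsuc-sub σ M with str unsuc M
... | just M₀ = refl
... | nothing = sub-float v zero M

nf-sub : {σ τ : Fin n → Term n₁ m} → Values τ → (∀ x → nf (σ x) ≡ τ x) →
         ∀ M → nf (sub σ M) ≡ sub τ (nf M)
nfᴶ-sub : {σ τ : Fin n → Term n₁ m} → Values τ → (∀ x → nf (σ x) ≡ τ x) →
          ∀ J → nfᴶ (subᴶ σ J) ≡ (proj₁ (nfᴶ J) , sub τ (proj₂ (nfᴶ J)))

nf-sub-lift : {σ τ : Fin n → Term n₁ m} → (∀ x → nf (σ x) ≡ τ x) →
              ∀ x → nf ((var zero ∷ wk ∘ σ) x) ≡ (var zero ∷ wk ∘ τ) x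
nf-sub-lift h zero = refl
nf-sub-lift {σ = σ} h (suc x) = trans (nf-ren suc id (σ x)) (cong wk (h x))

nf-sub v h (var x)      = h x
nf-sub v h (ƛ M)        = cong ƛ_ (nf-sub (values-lift v) (nf-sub-lift h) M)
nf-sub v h (M · N)      = cong₂ _·_ (nf-sub v h M) (nf-sub v h N)
nf-sub v h (L where≔ M) =
  trans (cong₂ whr (nf-sub (values-lift v) (nf-sub-lift h) L) (nf-sub v h M))
        (sym (sub-whr v (nf L) (nf M)))
nf-sub {σ = σ} {τ} v h (μ J)
  rewrite nfᴶ-sub {σ = wkᵏ ∘ σ} {wkᵏ ∘ τ} (λ x → value-ren (v x))
                  (λ x → trans (nf-ren id suc (σ x)) (cong wkᵏ (h x))) J =
  sym (sub-mu v (proj₁ (nfᴶ J)) _)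
nfᴶ-sub v h ([ k ] M)    = cong (k ,_) (nf-sub v h M)
nfᴶ-sub v h (J where≔ M) =
  trans (cong₂ (λ (k , L) M → k , whr L M)
               (nfᴶ-sub (values-lift v) (nf-sub-lift h) J) (nf-sub v h M))
        (cong (proj₁ (nfᴶ J) ,_) (sym (sub-whr v _ (nf M))))

-- Redirection under renaming, and common preimages of renamings

lift-injective : {f : Fin n → Fin n₁} → Injective _≡_ _≡_ f → Injective _≡_ _≡_ (lift 1 f)
lift-injective i {zero}  {zero}  _ = refl
lift-injective i {suc x} {suc y} e = cong suc (i (suc-injective e))

-- Without injectivity another label could be identified with `k` and then be redirected on the
-- right-hand side only.
redirect-ren : {κ : Fin m → Fin m₁} → Injective _≡_ _≡_ κ → ∀ (ρ : Fin n → Fin n₁) k R M →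
               ren ρ κ (redirect k R M) ≡ redirect (κ k) (ren (lift 1 ρ) κ R) (ren ρ κ M)
redirectᴶ-ren : {κ : Fin m → Fin m₁} → Injective _≡_ _≡_ κ → ∀ (ρ : Fin n → Fin n₁) k R J →
                renᴶ ρ κ (redirectᴶ k R J) ≡ redirectᴶ (κ k) (ren (lift 1 ρ) κ R) (renᴶ ρ κ J)
redirect-ren i ρ k R (var x) = refl
redirect-ren {κ = κ} i ρ k R (ƛ M) = cong ƛ_
  (trans (redirect-ren i (lift 1 ρ) k (wk₁ R) M) (cong (λ R → redirect _ R _) (wk₁-ren ρ κ R)))
redirect-ren i ρ k R (M · N) = cong₂ _·_ (redirect-ren i ρ k R M) (redirect-ren i ρ k R N)
redirect-ren {κ = κ} i ρ k R (L where≔ M) = cong₂ _where≔_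
  (trans (redirect-ren i (lift 1 ρ) k (wk₁ R) L) (cong (λ R → redirect _ R _) (wk₁-ren ρ κ R)))
  (redirect-ren i ρ k R M)
redirect-ren {κ = κ} i ρ k R (μ J) = cong μ_
  (trans (redirectᴶ-ren (lift-injective i) ρ (suc k) (wkᵏ R) J)
         (cong (λ R → redirectᴶ (suc (κ k)) R (renᴶ ρ (lift 1 κ) J)) (wkᵏ-ren (lift 1 ρ) κ R)))
redirectᴶ-ren {κ = κ} i ρ k R ([ j ] M) with j ≟ k | κ j ≟ κ k
... | yes _ | yes _ = cong (λ X → [ κ j ] (ren (lift 1 ρ) κ R where≔ X)) (redirect-ren i ρ k R M)
... | yes e | no ¬e = contradiction (cong κ e) ¬e
... | no ¬e | yes e = contradiction (i e) ¬e
... | no _  | no _  = cong ([ κ j ]_) (redirect-ren i ρ k R M)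
redirectᴶ-ren {κ = κ} i ρ k R (J where≔ M) = cong₂ _where≔_
  (trans (redirectᴶ-ren i (lift 1 ρ) k (wk₁ R) J)
         (cong (λ R → redirectᴶ (κ k) R (renᴶ (lift 1 ρ) κ J)) (wk₁-ren ρ κ R)))
  (redirect-ren i ρ k R M)

-- The existence half of a pullback square. Lifted to terms, it recovers side conditions: a
-- weakening that is also a renaming under a binder is the weakening of a renamed term.
Pullback : (Fin n₁ → Fin n₃) → (Fin n₂ → Fin n₃) → (Fin n → Fin n₁) → (Fin n → Fin n₂) → Set
Pullback f g h i = ∀ {x y} → f x ≡ g y → ∃[ z ] (x ≡ h z × y ≡ i z)

lift-pullback : {f : Fin n₁ → Fin n₃} {g : Fin n₂ → Fin n₃} {h : Fin n → Fin n₁} {i : Fin n → Fin n₂} →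
                Pullback f g h i → Pullback (lift 1 f) (lift 1 g) (lift 1 h) (lift 1 i)
lift-pullback p {zero}  {zero}  _ = zero , refl , refl
lift-pullback p {suc x} {suc y} e with p (suc-injective e)
... | z , refl , refl = suc z , refl , refl

id-pullback : {f : Fin n → Fin n₁} → Pullback id f f id
id-pullback {y = y} e = y , e , refl

suc-pullback : {f : Fin n → Fin n₁} → Pullback suc (lift 1 f) f suc
suc-pullback {y = suc y} refl = y , refl , refl

var-injective : {x y : Fin n} → _≡_ {A = Term n m} (var x) (var y) → x ≡ y
var-injective refl = refl

ƛ-injective : {M N : Term (suc n) m} → _≡_ {A = Term n m} (ƛ M) (ƛ N) → M ≡ N
ƛ-injective refl = refl

·-injective : {M M′ N N′ : Term n m} → M · N ≡ M′ · N′ → M ≡ M′ × N ≡ N′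
·-injective refl = refl , refl

where-injective : {L L′ : Term (suc n) m} {M M′ : Term n m} →
                  (L where≔ M) ≡ (L′ where≔ M′) → L ≡ L′ × M ≡ M′
where-injective refl = refl , refl

μ-injective : {I J : Jump n (suc m)} → (μ I) ≡ (μ J) → I ≡ J
μ-injective refl = refl

jump-injective : {k l : Fin m} {M N : Term n m} → ([ k ] M) ≡ ([ l ] N) → k ≡ l × M ≡ N
jump-injective refl = refl , refl

whereᴶ-injective : {I J : Jump (suc n) m} {M N : Term n m} →
                   (I where≔ M) ≡ (J where≔ N) → I ≡ J × M ≡ N
whereᴶ-injective refl = refl , refl

ren-pullback :
  {ρ₁ : Fin n₁ → Fin n₃} {ρ₂ : Fin n₂ → Fin n₃} {ρ₃ : Fin n → Fin n₁} {ρ₄ : Fin n → Fin n₂}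
  {κ₁ : Fin m₁ → Fin m₃} {κ₂ : Fin m₂ → Fin m₃} {κ₃ : Fin m → Fin m₁} {κ₄ : Fin m → Fin m₂} →
  Pullback ρ₁ ρ₂ ρ₃ ρ₄ → Pullback κ₁ κ₂ κ₃ κ₄ → ∀ L X → ren ρ₁ κ₁ L ≡ ren ρ₂ κ₂ X →
  ∃[ Y ] (L ≡ ren ρ₃ κ₃ Y × X ≡ ren ρ₄ κ₄ Y)
renᴶ-pullback :
  {ρ₁ : Fin n₁ → Fin n₃} {ρ₂ : Fin n₂ → Fin n₃} {ρ₃ : Fin n → Fin n₁} {ρ₄ : Fin n → Fin n₂}
  {κ₁ : Fin m₁ → Fin m₃} {κ₂ : Fin m₂ → Fin m₃} {κ₃ : Fin m → Fin m₁} {κ₄ : Fin m → Fin m₂} →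
  Pullback ρ₁ ρ₂ ρ₃ ρ₄ → Pullback κ₁ κ₂ κ₃ κ₄ → ∀ I J → renᴶ ρ₁ κ₁ I ≡ renᴶ ρ₂ κ₂ J →
  ∃[ J₀ ] (I ≡ renᴶ ρ₃ κ₃ J₀ × J ≡ renᴶ ρ₄ κ₄ J₀)
ren-pullback r k (var x) (var y) e with r (var-injective e)
... | z , refl , refl = var z , refl , refl
ren-pullback r k (ƛ L) (ƛ X) e with ren-pullback (lift-pullback r) k L X (ƛ-injective e)
... | Y , refl , refl = (ƛ Y) , refl , refl
ren-pullback r k (L · M) (X · X′) e
  with ren-pullback r k L X (proj₁ (·-injective e)) | ren-pullback r k M X′ (proj₂ (·-injective e))
... | Y , refl , refl | Y′ , refl , refl = (Y · Y′) , refl , refl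
ren-pullback r k (L where≔ M) (X where≔ X′) e
  with ren-pullback (lift-pullback r) k L X (proj₁ (where-injective e))
     | ren-pullback r k M X′ (proj₂ (where-injective e))
... | Y , refl , refl | Y′ , refl , refl = (Y where≔ Y′) , refl , refl
ren-pullback r k (μ I) (μ J) e with renᴶ-pullback r (lift-pullback k) I J (μ-injective e)
... | Y , refl , refl = (μ Y) , refl , refl
renᴶ-pullback r k ([ i ] M) ([ j ] X) e
  with k (proj₁ (jump-injective e)) | ren-pullback r k M X (proj₂ (jump-injective e))
... | l , refl , refl | Y , refl , refl = ([ l ] Y) , refl , refl
renᴶ-pullback r k (I where≔ M) (J where≔ X) e
  with renᴶ-pullback (lift-pullback r) k I J (proj₁ (whereᴶ-injective e))
     | ren-pullback r k M X (proj₂ (whereᴶ-injective e))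
... | Y , refl , refl | Y′ , refl , refl = (Y where≔ Y′) , refl , refl

wk-pullback : {ρ : Fin n → Fin n₁} {κ : Fin m → Fin m₁} → ∀ L X → wk L ≡ ren (lift 1 ρ) κ X →
              ∃[ Y ] (L ≡ ren ρ κ Y × X ≡ wk Y)
wk-pullback = ren-pullback suc-pullback id-pullback

wkᵏ-pullback : {ρ : Fin n → Fin n₁} {κ : Fin m → Fin m₁} → ∀ L X → wkᵏ L ≡ ren ρ (lift 1 κ) X →
               ∃[ Y ] (L ≡ ren ρ κ Y × X ≡ wkᵏ Y)
wkᵏ-pullback = ren-pullback id-pullback suc-pullback

-- Reductions of a renamed term are renamings of reductions

-- The map `ρ` is arbitrary, but `κ` has to be injective because β-μ compares labels.
Reflects : (∀ {n m} → Rel (Term n m) 0ℓ) → Set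
Reflects R = ∀ {n m n₁ m₁} {ρ : Fin n → Fin n₁} {κ : Fin m → Fin m₁} → Injective _≡_ _≡_ κ →
             ∀ M {X N} → R X N → X ≡ ren ρ κ M → ∃[ N₀ ] (N ≡ ren ρ κ N₀ × R M N₀)

Reflectsᴶ : (∀ {n m} → Rel (Jump n m) 0ℓ) → Set
Reflectsᴶ S = ∀ {n m n₁ m₁} {ρ : Fin n → Fin n₁} {κ : Fin m → Fin m₁} → Injective _≡_ _≡_ κ →
              ∀ J {X I} → S X I → X ≡ renᴶ ρ κ J → ∃[ I₀ ] (I ≡ renᴶ ρ κ I₀ × S J I₀)

E-reflects : Reflects E
E-reflects {ρ = ρ} {κ} i (L where≔ (M where≔ N)) E1 refl =
  _ , cong (λ L → L where≔ _ where≔ _) (sym (wk₁-ren ρ κ L)) , E1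
E-reflects {ρ = ρ} {κ} i ((μ J) where≔ M) E2 refl =
  _ , cong (λ M → μ (_ where≔ M)) (sym (wkᵏ-ren ρ κ M)) , E2

-- Since ≈ is symmetric, (E1) and (E2) are also used from right to left. The non-occurrence
-- condition then lies on the source, and the pullback lemmas show that it held before the renaming.
E⁻-reflects : Reflects (flip E)
E⁻-reflects i ((L where≔ M) where≔ N) (E1 {L = L₁}) e with where-injective e
... | e , refl with where-injective e
... | e , refl with ren-pullback (lift-pullback suc-pullback) id-pullback L₁ L e
... | _ , refl , refl = _ , refl , E1
E⁻-reflects {ρ = ρ} {κ} i (μ (J where≔ M)) (E2 {M = M₁}) e with whereᴶ-injective (μ-injective e)
... | refl , e with wkᵏ-pullback {ρ = ρ} {κ} M₁ M e
... | _ , refl , refl = _ , refl , E2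

Eᴶ-reflects : Reflectsᴶ Eᴶ
Eᴶ-reflects i ([ k ] (L where≔ M)) E3 refl = _ , refl , E3

Eᴶ⁻-reflects : Reflectsᴶ (flip Eᴶ)
Eᴶ⁻-reflects i (([ k ] L) where≔ M) E3 refl = _ , refl , E3

Rule-reflects : Reflects Rule
Rule-reflects {ρ = ρ} {κ} i (N · M) (ad₁ nv) refl =
  _ , cong (λ M → var zero · M where≔ _) (sym (wk-ren ρ κ M)) , ad₁ (nv ∘ value-ren)
Rule-reflects {ρ = ρ} {κ} i (V · N) (ad₂ v nv) refl =
  _ , cong (λ V → V · var zero where≔ _) (sym (wk-ren ρ κ V)) , ad₂ (value-ren⁻ V v) (nv ∘ value-ren)
Rule-reflects i ((ƛ M) · V) (β-λ v) refl = _ , refl , β-λ (value-ren⁻ V v)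
Rule-reflects i (M where≔ V) (β-let v) refl =
  _ , sub-ren (λ { zero → refl ; (suc x) → refl }) M , β-let (value-ren⁻ V v)
Rule-reflects {ρ = ρ} {κ} i (M where≔ (μ J)) β-μ refl =
  _ , cong μ_ (trans (cong (λ M → redirectᴶ zero M (renᴶ ρ (lift 1 κ) J)) (sym (wkᵏ-ren (lift 1 ρ) κ M)))
                     (sym (redirectᴶ-ren (lift-injective i) ρ zero (wkᵏ M) J))) , β-μ
Rule-reflects {ρ = ρ} {κ} i (ƛ (V · var zero)) (η-λ {V₁} v) e
  with wk-pullback {ρ = ρ} {κ} V₁ V (proj₁ (·-injective (ƛ-injective e)))
... | V₀ , refl , refl = V₀ , refl , η-λ (value-ren⁻ V₀ v)
Rule-reflects i (var zero where≔ M) η-let refl = M , refl , η-let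
Rule-reflects {ρ = ρ} {κ} i (μ [ zero ] M) (vertical (η-μ {M₁})) e
  with wkᵏ-pullback {ρ = ρ} {κ} M₁ M (proj₂ (jump-injective (μ-injective e)))
... | M₀ , refl , refl = M₀ , refl , vertical η-μ

Ruleᴶ-reflects : Reflectsᴶ Ruleᴶ
Ruleᴶ-reflects i ([ l ] (μ J)) β-jmp refl =
  _ , trans (renᴶ-renᴶ (λ _ → refl) (λ _ → refl) J)
            (sym (renᴶ-renᴶ (λ _ → refl) (λ { zero → refl ; (suc k) → refl }) J)) , β-jmp

module _ {R : ∀ {n m} → Rel (Term n m) 0ℓ} {S : ∀ {n m} → Rel (Jump n m) 0ℓ} where

  step-flip  : {M N : Term n m} → Compatible.Step R S M N → Compatible.Step (flip R) (flip S) N M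
  stepᴶ-flip : {I J : Jump n m} → Compatible.Stepᴶ R S I J → Compatible.Stepᴶ (flip R) (flip S) J I
  step-flip (root r)    = root r
  step-flip (ƛ s)       = ƛ step-flip s
  step-flip (appˡ s)    = appˡ (step-flip s)
  step-flip (appʳ s)    = appʳ (step-flip s)
  step-flip (whereˡ s)  = whereˡ (step-flip s)
  step-flip (whereʳ s)  = whereʳ (step-flip s)
  step-flip (μ s)       = μ stepᴶ-flip s
  stepᴶ-flip (root r)   = root r
  stepᴶ-flip (jump s)   = jump (step-flip s)
  stepᴶ-flip (whereˡ s) = whereˡ (stepᴶ-flip s)
  stepᴶ-flip (whereʳ s) = whereʳ (step-flip s)

  module _ (R-reflects : Reflects R) (S-reflects : Reflectsᴶ S) where
    step-reflects  : Reflects (Compatible.Step R S)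
    stepᴶ-reflects : Reflectsᴶ (Compatible.Stepᴶ R S)
    step-reflects i M (root r) e with R-reflects i M r e
    ... | _ , eq , r′ = _ , eq , root r′
    step-reflects i (ƛ M) (ƛ s) refl with step-reflects i M s refl
    ... | _ , refl , s′ = _ , refl , ƛ s′
    step-reflects i (M · N) (appˡ s) refl with step-reflects i M s refl
    ... | _ , refl , s′ = _ , refl , appˡ s′
    step-reflects i (M · N) (appʳ s) refl with step-reflects i N s refl
    ... | _ , refl , s′ = _ , refl , appʳ s′
    step-reflects i (L where≔ M) (whereˡ s) refl with step-reflects i L s refl
    ... | _ , refl , s′ = _ , refl , whereˡ s′
    step-reflects i (L where≔ M) (whereʳ s) refl with step-reflects i M s refl
    ... | _ , refl , s′ = _ , refl , whereʳ s′
    step-reflects i (μ J) (μ s) refl with stepᴶ-reflects (lift-injective i) J s refl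
    ... | _ , refl , s′ = _ , refl , μ s′
    stepᴶ-reflects i J (root r) e with S-reflects i J r e
    ... | _ , eq , r′ = _ , eq , root r′
    stepᴶ-reflects i ([ k ] M) (jump s) refl with step-reflects i M s refl
    ... | _ , refl , s′ = _ , refl , jump s′
    stepᴶ-reflects i (J where≔ M) (whereˡ s) refl with stepᴶ-reflects i J s refl
    ... | _ , refl , s′ = _ , refl , whereˡ s′
    stepᴶ-reflects i (J where≔ M) (whereʳ s) refl with step-reflects i M s refl
    ... | _ , refl , s′ = _ , refl , whereʳ s′

≈-reflects : Reflects _≈_
≈-reflects i M ε e = M , e , ε
≈-reflects i M (fwd s ◅ r) e with step-reflects E-reflects Eᴶ-reflects i M s e
... | N , eq , s′ with ≈-reflects i N r eq
... | P , eq′ , r′ = P , eq′ , fwd s′ ◅ r′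
≈-reflects i M (bwd s ◅ r) e with step-reflects E⁻-reflects Eᴶ⁻-reflects i M (step-flip s) e
... | N , eq , s′ with ≈-reflects i N r eq
... | P , eq′ , r′ = P , eq′ , bwd (step-flip s′) ◅ r′

⟶*-reflects : Reflects _⟶*_
⟶*-reflects i M ε e = M , e , ε
⟶*-reflects i M (inj₁ s ◅ r) e with ≈-reflects i M s e
... | N , eq , s′ with ⟶*-reflects i N r eq
... | P , eq′ , r′ = P , eq′ , inj₁ s′ ◅ r′
⟶*-reflects i M (inj₂ (_ , _ , e₁ , s , e₂) ◅ r) e with ≈-reflects i M e₁ e
... | N₁ , eq₁ , e₁′ with step-reflects Rule-reflects Ruleᴶ-reflects i N₁ s eq₁
... | N₂ , eq₂ , s′ with ≈-reflects i N₂ e₂ eq₂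
... | N₃ , eq₃ , e₂′ with ⟶*-reflects i N₃ r eq₃
... | P , eq′ , r′ = P , eq′ , inj₂ (_ , _ , e₁′ , s′ , e₂′) ◅ r′

step-vertical : {M N : Term n m} →
  Compatible.Step Vertical (λ _ _ → ⊥) M N → Compatible.Step Rule Ruleᴶ M N
stepᴶ-vertical : {I J : Jump n m} →
  Compatible.Stepᴶ Vertical (λ _ _ → ⊥) I J → Compatible.Stepᴶ Rule Ruleᴶ I J
step-vertical (root r)    = root (vertical r)
step-vertical (ƛ s)       = ƛ step-vertical s
step-vertical (appˡ s)    = appˡ (step-vertical s)
step-vertical (appʳ s)    = appʳ (step-vertical s)
step-vertical (whereˡ s)  = whereˡ (step-vertical s)
step-vertical (whereʳ s)  = whereʳ (step-vertical s)
step-vertical (μ s)       = μ stepᴶ-vertical s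
stepᴶ-vertical (jump s)   = jump (step-vertical s)
stepᴶ-vertical (whereˡ s) = whereˡ (stepᴶ-vertical s)
stepᴶ-vertical (whereʳ s) = whereʳ (step-vertical s)

⟶ᵛ*-⟶* : {M N : Term n m} → M ⟶ᵛ* N → M ⟶* N
⟶ᵛ*-⟶* = Star.map λ where
  (inj₁ e)                     → inj₁ e
  (inj₂ (_ , _ , e₁ , s , e₂)) → inj₂ (_ , _ , e₁ , step-vertical s , e₂)

≡-⟶* : {M N : Term n m} → M ≡ N → M ⟶* N
≡-⟶* refl = ε

nf-⟶* : (M : Term n m) → M ⟶* nf M
nf-⟶* M = ⟶ᵛ*-⟶* (nf-reduces M)

rule-⟶* : {M N : Term n m} → Rule M N → M ⟶* N
rule-⟶* r = reduces-step (root r)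

-- Reduction of canonical jumps

whrᴶ : Fin m × Term (suc n) m → Term n m → Fin m × Term n m
whrᴶ J M = proj₁ J , whr (proj₂ J) M

muᴶ : Fin (suc m) × Term n (suc m) → Term n m
muᴶ J = mu (proj₁ J) (proj₂ J)

infix 4 _⇒_ _⇒*_

-- A canonical jump (k , L) stands for [k]L.  Its only reductions are those inside L
-- and β-jmp at the root.
data _⇒_ {n m} : Rel (Fin m × Term n m) 0ℓ where
  inner : ∀ {k L L′} → L ⟶* L′ → (k , L) ⇒ (k , L′)
  cut   : ∀ k j P → (k , mu j P) ⇒ ((k ∷ id) j , ren id (k ∷ id) P)

_⇒*_ : Rel (Fin m × Term n m) 0ℓ
_⇒*_ = Star _⇒_

≡-⇒* : {I J : Fin m × Term n m} → I ≡ J → I ⇒* J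
≡-⇒* refl = ε

-- For a cut, `whr-mu` brings the `where` inside the μ, so that the cut is at the head again;
-- replacing the bound label leaves `wkᵏ M` as `M`.
⇒-whrᴶ : {I J : Fin m × Term (suc n) m} (M : Term n m) → I ⇒ J → whrᴶ I M ⇒ whrᴶ J M
⇒-whrᴶ M (inner r)   = inner (reduces-whr r ε)
⇒-whrᴶ M (cut k j P) = subst₂ _⇒_ (cong (k ,_) (sym (whr-mu j P M)))
  (cong ((k ∷ id) j ,_) (trans (whr-ren id (k ∷ id) P (wkᵏ M)) (cong₂ whr
    (ren-cong (lift-id (λ _ → refl)) (λ _ → refl) P)
    (trans (ren-ren (λ _ → refl) (λ _ → refl) M) (ren-id (λ _ → refl) (λ _ → refl) M)))))
  (cut k j (whr P (wkᵏ M)))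

mu-⟶* : ∀ k (L : Term n (suc m)) → μ [ k ] L ⟶* mu k L
mu-⟶* k L = ⟶ᵛ*-⟶* (mu-reduces k L)

mu-cong : ∀ k {L L′ : Term n (suc m)} → L ⟶* L′ → mu k L ⟶* mu k L′
mu-cong k {L} r with mu-view k L
... | keep e = reduces-≈ e ◅◅ reduces-jump k r ◅◅ mu-⟶* k _
... | collapse X with ⟶*-reflects suc-injective X r refl
... | X′ , refl , r′ = subst₂ _⟶*_ (sym (mu-wkᵏ X)) (sym (mu-wkᵏ X′)) r′

cut-wkᵏ : ∀ (k : Fin m) (M : Term n m) → ren id (k ∷ id) (wkᵏ M) ≡ M
cut-wkᵏ k M = trans (ren-ren (λ _ → refl) (λ _ → refl) M) (ren-id (λ _ → refl) (λ _ → refl) M)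

mu-jmp : ∀ k {L : Term n (suc m)} j P → L ≈ μ [ j ] P →
         mu k L ⟶* mu ((k ∷ id) j) (ren id (k ∷ id) P)
mu-jmp k {L} j P e with mu-view k L
... | keep e′ = reduces-≈ (e′ ◅◅ Eq.gmap (λ M → μ [ k ] M) (λ s → μ jump s) e)
             ◅◅ reduces-step (μ root β-jmp) ◅◅ mu-⟶* _ _
-- No outer μ is left to fire β-jmp. By reflection `X` is itself a μ up to ≈, not mentioning the
-- outer variable, so the cut merely renames its bound label to the outer one and yields `mu j₀ P₀`.
... | collapse X with ≈-reflects suc-injective X e refl
... | μ [ j₀ ] P₀ , refl , e₀ =
  ≡-⟶* (mu-wkᵏ X) ◅◅ reduces-≈ e₀ ◅◅ mu-⟶* j₀ P₀ ◅◅
  ≡-⟶* (cong₂ mu (sym (unlift j₀)) (sym (trans (ren-ren (λ _ → refl) unlift P₀)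
                                              (ren-id (λ _ → refl) (λ _ → refl) P₀))))
  where
  unlift : (zero ∷ id) ∘ lift 1 suc ≗ id
  unlift zero    = refl
  unlift (suc k) = refl

⇒-muᴶ : {I J : Fin (suc m) × Term n (suc m)} → I ⇒ J → muᴶ I ⟶* muᴶ J
⇒-muᴶ (inner {k} r) = mu-cong k r
⇒-muᴶ (cut k j P) with mu-view j P
... | keep e     = mu-jmp k j P e
-- Here `mu j P` has no μ to cut and is just `Y`, which is also what the cut returns.
... | collapse Y = ≡-⟶* (cong (mu k) (trans (mu-wkᵏ Y) (sym (cut-wkᵏ k Y))))

⇒*-muᴶ : {I J : Fin (suc m) × Term n (suc m)} → I ⇒* J → muᴶ I ⟶* muᴶ J
⇒*-muᴶ = Star.kleisliStar muᴶ ⇒-muᴶ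

⇒*-whrᴶ : {I J : Fin m × Term (suc n) m} (M : Term n m) → I ⇒* J → whrᴶ I M ⇒* whrᴶ J M
⇒*-whrᴶ M = Star.gmap (λ I → whrᴶ I M) (⇒-whrᴶ M)

-- Redirection and canonical forms

redirect-fresh : ∀ {k : Fin m₁} {κ : Fin m → Fin m₁} → (∀ j → κ j ≢ k) →
                 ∀ (ρ : Fin n → Fin n₁) R M → redirect k R (ren ρ κ M) ≡ ren ρ κ M
redirectᴶ-fresh : ∀ {k : Fin m₁} {κ : Fin m → Fin m₁} → (∀ j → κ j ≢ k) →
                  ∀ (ρ : Fin n → Fin n₁) R J → redirectᴶ k R (renᴶ ρ κ J) ≡ renᴶ ρ κ J
redirect-fresh f ρ R (var x)      = refl
redirect-fresh f ρ R (ƛ M)        = cong ƛ_ (redirect-fresh f (lift 1 ρ) (wk₁ R) M)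
redirect-fresh f ρ R (M · N)      = cong₂ _·_ (redirect-fresh f ρ R M) (redirect-fresh f ρ R N)
redirect-fresh f ρ R (L where≔ M) =
  cong₂ _where≔_ (redirect-fresh f (lift 1 ρ) (wk₁ R) L) (redirect-fresh f ρ R M)
redirect-fresh f ρ R (μ J)        = cong μ_
  (redirectᴶ-fresh (λ { zero () ; (suc j) e → f j (suc-injective e) }) ρ (wkᵏ R) J)
redirectᴶ-fresh {k = k} {κ} f ρ R ([ j ] M) with κ j ≟ k
... | yes e = contradiction e (f j)
... | no _  = cong ([ κ j ]_) (redirect-fresh f ρ R M)
redirectᴶ-fresh f ρ R (J where≔ M) =
  cong₂ _where≔_ (redirectᴶ-fresh f (lift 1 ρ) (wk₁ R) J) (redirect-fresh f ρ R M)

-- Isolates the label test that `redirectᴶ` makes at the head of a canonical jump, so that the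
-- equations below can move a `where` past it uniformly.
divert : Fin m → Term (suc n) m → Fin m → Term n m → Term n m
divert k R j M with j ≟ k
... | yes _ = whr R M
... | no _  = M

divert-whr : ∀ k R j (L : Term (suc n) m) M → divert k R j (whr L M) ≡ whr (divert k (wk₁ R) j L) M
divert-whr k R j L M with j ≟ k
... | yes _ = whr-assoc R L M
... | no _  = refl

nf-redirect-jump : ∀ k R j (M : Term n m) →
                   nfᴶ (redirectᴶ k R ([ j ] M)) ≡ (j , divert k (nf R) j (nf (redirect k R M)))
nf-redirect-jump k R j M with j ≟ k
... | yes _ = refl
... | no _  = refl

wk₁-redirect : ∀ k R (L : Term (suc n) m) →
               wk₁ (nf (redirect k (wk₁ R) L)) ≡ nf (redirect k (wk₁ (wk₁ R)) (wk₁ L))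
wk₁-redirect k R L = trans (sym (nf-ren _ _ (redirect k (wk₁ R) L)))
  (cong nf (trans (redirect-ren id (lift 1 suc) k (wk₁ R) L)
                  (cong (λ R → redirect k R (wk₁ L)) (wk₁-ren suc id R))))

wkᵏ-redirect : ∀ k R (M : Term n m) →
               wkᵏ (redirect k R M) ≡ redirect (suc k) (wkᵏ R) (wkᵏ M)
wkᵏ-redirect k R M = trans (redirect-ren suc-injective id k R M)
  (cong (λ R → redirect (suc k) R (wkᵏ M)) (ren-cong (lift-id (λ _ → refl)) (λ _ → refl) R))

nf-redirect-whr : ∀ k R (L : Term (suc n) m) M →
                  nf (redirect k R (whr L M)) ≡ nf (redirect k R (L where≔ M))
nf-redirect-whr k R L (var x)      = refl
nf-redirect-whr k R L (ƛ M)        = refl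
nf-redirect-whr k R L (M · N)      = refl
nf-redirect-whr k R L (M where≔ N) = begin
  whr (nf (redirect k (wk₁ R) (whr (wk₁ L) M))) n′
    ≡⟨ cong (λ X → whr X n′) (nf-redirect-whr k (wk₁ R) (wk₁ L) M) ⟩
  whr (whr (nf (redirect k (wk₁ (wk₁ R)) (wk₁ L))) m′) n′
    ≡⟨ cong (λ X → whr (whr X m′) n′) (wk₁-redirect k R L) ⟨
  whr (whr (wk₁ (nf (redirect k (wk₁ R) L))) m′) n′
    ≡⟨ whr-assoc (nf (redirect k (wk₁ R) L)) m′ n′ ⟨
  whr (nf (redirect k (wk₁ R) L)) (whr m′ n′) ∎
  where
  open ≡-Reasoning
  m′ = nf (redirect k (wk₁ R) M)
  n′ = nf (redirect k R N)
nf-redirect-whr k R L (μ J)        = refl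

-- If `j` is the redirected label, the floated `where` must leave the inserted `R where≔` as well as
-- the jump; this is (E1), in the form of `divert-whr`.
nf-redirect-float : ∀ k R j (L : Term n (suc m)) →
                    nf (redirect k R (float j L)) ≡ nf (redirect k R (μ [ j ] L))
nf-redirect-float k R j (var x)      = refl
nf-redirect-float k R j (ƛ L)        = refl
nf-redirect-float k R j (L · M)      = refl
nf-redirect-float k R j (L where≔ A) with str unsuc A in eq
... | nothing = refl
... | just A₀ rewrite unsuc-just A eq = begin
  whr (nf (redirect k (wk₁ R) (float j L))) a
    ≡⟨ cong (λ X → whr X a) (nf-redirect-float k (wk₁ R) j L) ⟩
  whr (muᴶ (nfᴶ (redirectᴶ (suc k) (wkᵏ (wk₁ R)) ([ j ] L)))) a
    ≡⟨ cong (λ J → whr (muᴶ J) a) (nf-redirect-jump (suc k) (wkᵏ (wk₁ R)) j L) ⟩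
  whr (mu j (divert (suc k) (nf (wkᵏ (wk₁ R))) j (nf (redirect (suc k) (wkᵏ (wk₁ R)) L)))) a
    ≡⟨ cong (λ X → whr (mu j (divert (suc k) (nf X) j (nf (redirect (suc k) X L)))) a)
            (ren-swap (λ _ → refl) (λ _ → refl) R) ⟩
  whr (mu j (divert (suc k) (nf (wk₁ (wkᵏ R))) j l)) a
    ≡⟨ cong (λ X → whr (mu j (divert (suc k) X j l)) a) (nf-ren (lift 1 suc) id (wkᵏ R)) ⟩
  whr (mu j (divert (suc k) (wk₁ (nf (wkᵏ R))) j l)) a
    ≡⟨ whr-mu j _ a ⟩
  mu j (whr (divert (suc k) (wk₁ (nf (wkᵏ R))) j l) (wkᵏ a))
    ≡⟨ cong (mu j) (divert-whr (suc k) (nf (wkᵏ R)) j l (wkᵏ a)) ⟨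
  mu j (divert (suc k) (nf (wkᵏ R)) j (whr l (wkᵏ a)))
    ≡⟨ cong (λ X → mu j (divert (suc k) (nf (wkᵏ R)) j (whr l X)))
            (trans (sym (nf-ren id suc (redirect k R A₀))) (cong nf (wkᵏ-redirect k R A₀))) ⟩
  mu j (divert (suc k) (nf (wkᵏ R)) j (nf (redirect (suc k) (wkᵏ R) (L where≔ wkᵏ A₀))))
    ≡⟨ cong muᴶ (nf-redirect-jump (suc k) (wkᵏ R) j (L where≔ wkᵏ A₀)) ⟨
  nf (redirect k R (μ [ j ] (L where≔ wkᵏ A₀))) ∎
  where
  open ≡-Reasoning
  a = nf (redirect k R A₀)
  l = nf (redirect (suc k) (wk₁ (wkᵏ R)) L)
nf-redirect-float k R j (μ J)        = refl

nf-redirect-mu : ∀ k R j (L : Term n (suc m)) →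
                 nf (redirect k R (mu j L)) ≡ nf (redirect k R (μ [ j ] L))
nf-redirect-mu k R (suc j) L = nf-redirect-float k R (suc j) L
nf-redirect-mu k R zero L with str unsuc L in eq
... | nothing = nf-redirect-float k R zero L
... | just L₀ rewrite unsuc-just L eq | sym (wkᵏ-redirect k R L₀) =
  sym (Vertical-nf (η-μ {M = redirect k R L₀}))

-- Needed because β-μ fires on a canonical representative, while its result is compared with
-- redirection in the original jump. Redirection inserts wheres that may have to float, so the
-- right-hand side is normalised again.
nf-redirect  : ∀ k R (M : Term n m) → nf (redirect k R M) ≡ nf (redirect k R (nf M))
nfᴶ-redirect : ∀ k R (J : Jump n m) →
  nfᴶ (redirectᴶ k R J) ≡ nfᴶ (redirectᴶ k R ([ proj₁ (nfᴶ J) ] proj₂ (nfᴶ J)))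
nf-redirect k R (var x)      = refl
nf-redirect k R (ƛ M)        = cong ƛ_ (nf-redirect k (wk₁ R) M)
nf-redirect k R (M · N)      = cong₂ _·_ (nf-redirect k R M) (nf-redirect k R N)
nf-redirect k R (L where≔ M) = trans
  (cong₂ whr (nf-redirect k (wk₁ R) L) (nf-redirect k R M)) (sym (nf-redirect-whr k R (nf L) (nf M)))
nf-redirect k R (μ J)        = trans
  (cong muᴶ (nfᴶ-redirect (suc k) (wkᵏ R) J)) (sym (nf-redirect-mu k R (proj₁ (nfᴶ J)) _))
nfᴶ-redirect k R ([ j ] M)    = begin
  nfᴶ (redirectᴶ k R ([ j ] M))
    ≡⟨ nf-redirect-jump k R j M ⟩
  (j , divert k (nf R) j (nf (redirect k R M)))
    ≡⟨ cong (λ X → j , divert k (nf R) j X) (nf-redirect k R M) ⟩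
  (j , divert k (nf R) j (nf (redirect k R (nf M))))
    ≡⟨ nf-redirect-jump k R j (nf M) ⟨
  nfᴶ (redirectᴶ k R ([ j ] nf M)) ∎
  where open ≡-Reasoning
nfᴶ-redirect k R (J where≔ M) = begin
  whrᴶ (nfᴶ (redirectᴶ k (wk₁ R) J)) (nf (redirect k R M))
    ≡⟨ cong₂ whrᴶ (nfᴶ-redirect k (wk₁ R) J) (nf-redirect k R M) ⟩
  whrᴶ (nfᴶ (redirectᴶ k (wk₁ R) ([ j ] P))) x
    ≡⟨ cong (λ J → whrᴶ J x) (nf-redirect-jump k (wk₁ R) j P) ⟩
  (j , whr (divert k (nf (wk₁ R)) j (nf (redirect k (wk₁ R) P))) x)
    ≡⟨ cong (λ R′ → j , whr (divert k R′ j (nf (redirect k (wk₁ R) P))) x) (nf-ren (lift 1 suc) id R) ⟩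
  (j , whr (divert k (wk₁ (nf R)) j (nf (redirect k (wk₁ R) P))) x)
    ≡⟨ cong (j ,_) (divert-whr k (nf R) j _ x) ⟨
  (j , divert k (nf R) j (nf (redirect k R (P where≔ nf M))))
    ≡⟨ cong (λ X → j , divert k (nf R) j X) (nf-redirect-whr k R P (nf M)) ⟨
  (j , divert k (nf R) j (nf (redirect k R (whr P (nf M)))))
    ≡⟨ nf-redirect-jump k R j (whr P (nf M)) ⟨
  nfᴶ (redirectᴶ k R ([ j ] whr P (nf M))) ∎
  where
  open ≡-Reasoning
  j = proj₁ (nfᴶ J)
  P = proj₂ (nfᴶ J)
  x = nf (redirect k R (nf M))

β-μ-nf : ∀ (L : Term (suc n) m) J → whr L (nf (μ J)) ⟶* nf (μ redirectᴶ zero (wkᵏ L) J)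
β-μ-nf L J = go (proj₁ (nfᴶ J)) (proj₂ (nfᴶ J)) ◅◅ ≡-⟶* (cong muᴶ (sym (nfᴶ-redirect zero (wkᵏ L) J)))
  where
  go : ∀ j P → whr L (mu j P) ⟶* nf (μ redirectᴶ zero (wkᵏ L) ([ j ] P))
  go j P with mu-view j P
  ... | keep e = reduces-≈ (≈-sym (whr-≈ L (mu j P)) ◅◅ Eq.gmap (L where≔_) whereʳ e) ◅◅
                 rule-⟶* β-μ ◅◅ nf-⟶* _
  -- β-μ has no μ to act on. Its would-be result is `μ [ zero ] wkᵏ (L where≔ Y)`, which contracts
  -- vertically to `L where≔ Y`.
  ... | collapse Y rewrite mu-wkᵏ Y =
    reduces-≈ (≈-sym (whr-≈ L Y)) ◅◅ nf-⟶* (L where≔ Y) ◅◅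
    ≡-⟶* (trans (sym (Vertical-nf (η-μ {M = L where≔ Y})))
         (cong₂ (λ X Y → mu zero (whr (nf X) (nf Y)))
           (ren-cong (lift-id (λ _ → refl)) (λ _ → refl) L)
           (sym (redirect-fresh (λ _ ()) id (wkᵏ L) Y))))

-- The inverse translation under renaming and substitution

⁻¹-ren : (ρ : Fin n → Fin n₁) (κ : Fin m → Fin m₁) → ∀ t → (renT ρ κ t) ⁻¹ ≡ ren ρ κ (t ⁻¹)
⁻¹Q-ren : (ρ : Fin n → Fin n₁) (κ : Fin m → Fin m₁) → ∀ q → (renQ ρ κ q) ⁻¹Q ≡ renᴶ ρ κ (q ⁻¹Q)
⁻¹W-ren : (ρ : Fin n → Fin n₁) (κ : Fin m → Fin m₁) → ∀ w → (renW ρ κ w) ⁻¹W ≡ ren ρ κ (w ⁻¹W)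
⁻¹K-ren : (ρ : Fin n → Fin n₁) (κ : Fin m → Fin m₁) → ∀ c {A A′} → A′ ≡ ren ρ κ A →
          (renK ρ κ c) ⁻¹K[ A′ ] ≡ renᴶ ρ κ (c ⁻¹K[ A ])
⁻¹-ren ρ κ (ƛk q)   = cong μ_ (⁻¹Q-ren ρ (lift 1 κ) q)
⁻¹-ren ρ κ (v ·ᵂ w) = cong₂ _·_ (⁻¹W-ren ρ κ v) (⁻¹W-ren ρ κ w)
⁻¹Q-ren ρ κ (c ·ᴷ w) = ⁻¹K-ren ρ κ c (⁻¹W-ren ρ κ w)
⁻¹Q-ren ρ κ (t ·ᵀ c) = ⁻¹K-ren ρ κ c (⁻¹-ren ρ κ t)
⁻¹W-ren ρ κ (var x) = refl
⁻¹W-ren ρ κ (ƛx t)  = cong ƛ_ (⁻¹-ren (lift 1 ρ) κ t)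
⁻¹K-ren ρ κ (var k) refl = refl
⁻¹K-ren ρ κ (ƛx q)  refl = cong (_where≔ _) (⁻¹Q-ren (lift 1 ρ) κ q)

-- Three kinds of target substitution suffice: this one for `β` and `βx`, `Renames` for `βk` applied
-- to a variable, `Redirects` for `βk` applied to an abstraction.
record Substitutes {n m n₁ : ℕ} (σ : Fin n → W n₁ m) (τ : Fin m → K n₁ m)
                   (σ′ : Fin n → Term n₁ m) : Set where
  field
    values : ∀ x → (σ x) ⁻¹W ≡ σ′ x
    conts  : ∀ k → τ k ≡ var k
open Substitutes

substitutes-lift : {σ : Fin n → W n₁ m} {τ : Fin m → K n₁ m} {σ′ : Fin n → Term n₁ m} →
  Substitutes σ τ σ′ → Substitutes (var zero ∷ renW suc id ∘ σ) (renK suc id ∘ τ) (var zero ∷ wk ∘ σ′)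
substitutes-lift s .values zero = refl
substitutes-lift {σ = σ} s .values (suc x) = trans (⁻¹W-ren suc id (σ x)) (cong wk (s .values x))
substitutes-lift s .conts k = cong (renK suc id) (s .conts k)

substitutes-liftᵏ : {σ : Fin n → W n₁ m} {τ : Fin m → K n₁ m} {σ′ : Fin n → Term n₁ m} →
  Substitutes σ τ σ′ → Substitutes (renW id suc ∘ σ) (var zero ∷ renK id suc ∘ τ) (wkᵏ ∘ σ′)
substitutes-liftᵏ {σ = σ} s .values x = trans (⁻¹W-ren id suc (σ x)) (cong wkᵏ (s .values x))
substitutes-liftᵏ s .conts zero    = refl
substitutes-liftᵏ s .conts (suc k) = cong (renK id suc) (s .conts k)

⁻¹-sub : {σ : Fin n → W n₁ m} {τ : Fin m → K n₁ m} {σ′ : Fin n → Term n₁ m} →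
           Substitutes σ τ σ′ → ∀ t → (subT σ τ t) ⁻¹ ≡ sub σ′ (t ⁻¹)
⁻¹W-sub : {σ : Fin n → W n₁ m} {τ : Fin m → K n₁ m} {σ′ : Fin n → Term n₁ m} →
            Substitutes σ τ σ′ → ∀ w → (subW σ τ w) ⁻¹W ≡ sub σ′ (w ⁻¹W)
⁻¹Q-sub : {σ : Fin n → W n₁ m} {τ : Fin m → K n₁ m} {σ′ : Fin n → Term n₁ m} →
          Substitutes σ τ σ′ → ∀ q → (subQ σ τ q) ⁻¹Q ≡ subᴶ σ′ (q ⁻¹Q)
⁻¹K-sub : {σ : Fin n → W n₁ m} {τ : Fin m → K n₁ m} {σ′ : Fin n → Term n₁ m} →
          Substitutes σ τ σ′ → ∀ c {A A′} → A′ ≡ sub σ′ A →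
          (subK σ τ c) ⁻¹K[ A′ ] ≡ subᴶ σ′ (c ⁻¹K[ A ])
⁻¹-sub s (ƛk q)   = cong μ_ (⁻¹Q-sub (substitutes-liftᵏ s) q)
⁻¹-sub s (v ·ᵂ w) = cong₂ _·_ (⁻¹W-sub s v) (⁻¹W-sub s w)
⁻¹Q-sub s (c ·ᴷ w) = ⁻¹K-sub s c (⁻¹W-sub s w)
⁻¹Q-sub s (t ·ᵀ c) = ⁻¹K-sub s c (⁻¹-sub s t)
⁻¹W-sub s (var x) = s .values x
⁻¹W-sub s (ƛx t)  = cong ƛ_ (⁻¹-sub (substitutes-lift s) t)
⁻¹K-sub s (var k) refl rewrite s .conts k = refl
⁻¹K-sub s (ƛx q)  refl = cong (_where≔ _) (⁻¹Q-sub (substitutes-lift s) q)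

record Renames {n m n₁ m₁ : ℕ} (σ : Fin n → W n₁ m₁) (τ : Fin m → K n₁ m₁)
               (ρ : Fin n → Fin n₁) (κ : Fin m → Fin m₁) : Set where
  field
    values : ∀ x → σ x ≡ var (ρ x)
    conts  : ∀ k → τ k ≡ var (κ k)
open Renames

renames-lift : {σ : Fin n → W n₁ m₁} {τ : Fin m → K n₁ m₁} {ρ : Fin n → Fin n₁} {κ : Fin m → Fin m₁} →
  Renames σ τ ρ κ → Renames (var zero ∷ renW suc id ∘ σ) (renK suc id ∘ τ) (lift 1 ρ) κ
renames-lift r .values zero    = refl
renames-lift r .values (suc x) = cong (renW suc id) (r .values x)
renames-lift r .conts k        = cong (renK suc id) (r .conts k)

renames-liftᵏ : {σ : Fin n → W n₁ m₁} {τ : Fin m → K n₁ m₁} {ρ : Fin n → Fin n₁} {κ : Fin m → Fin m₁} →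
  Renames σ τ ρ κ → Renames (renW id suc ∘ σ) (var zero ∷ renK id suc ∘ τ) ρ (lift 1 κ)
renames-liftᵏ r .values x      = cong (renW id suc) (r .values x)
renames-liftᵏ r .conts zero    = refl
renames-liftᵏ r .conts (suc k) = cong (renK id suc) (r .conts k)

subT-ren : {σ : Fin n → W n₁ m₁} {τ : Fin m → K n₁ m₁} {ρ : Fin n → Fin n₁} {κ : Fin m → Fin m₁} →
           Renames σ τ ρ κ → ∀ t → subT σ τ t ≡ renT ρ κ t
subQ-ren : {σ : Fin n → W n₁ m₁} {τ : Fin m → K n₁ m₁} {ρ : Fin n → Fin n₁} {κ : Fin m → Fin m₁} →
           Renames σ τ ρ κ → ∀ q → subQ σ τ q ≡ renQ ρ κ q
subW-ren : {σ : Fin n → W n₁ m₁} {τ : Fin m → K n₁ m₁} {ρ : Fin n → Fin n₁} {κ : Fin m → Fin m₁} →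
           Renames σ τ ρ κ → ∀ w → subW σ τ w ≡ renW ρ κ w
subK-ren : {σ : Fin n → W n₁ m₁} {τ : Fin m → K n₁ m₁} {ρ : Fin n → Fin n₁} {κ : Fin m → Fin m₁} →
           Renames σ τ ρ κ → ∀ c → subK σ τ c ≡ renK ρ κ c
subT-ren r (ƛk q)   = cong ƛk_ (subQ-ren (renames-liftᵏ r) q)
subT-ren r (v ·ᵂ w) = cong₂ _·ᵂ_ (subW-ren r v) (subW-ren r w)
subQ-ren r (c ·ᴷ w) = cong₂ _·ᴷ_ (subK-ren r c) (subW-ren r w)
subQ-ren r (t ·ᵀ c) = cong₂ _·ᵀ_ (subT-ren r t) (subK-ren r c)
subW-ren r (var x)  = r .values x
subW-ren r (ƛx t)   = cong ƛx_ (subT-ren (renames-lift r) t)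
subK-ren r (var k)  = r .conts k
subK-ren r (ƛx q)   = cong ƛx_ (subQ-ren (renames-lift r) q)

-- σ and τ rename by ρ and κ, except that τ sends k₀ to a continuation ƛx cont
-- whose inverse image is  [κ k₀](R where x:=□)  up to canonical form.
record Redirects {n m n₁ m₁ : ℕ} (σ : Fin n → W n₁ m₁) (τ : Fin m → K n₁ m₁)
                 (ρ : Fin n → Fin n₁) (κ : Fin m → Fin m₁)
                 (k₀ : Fin m) (R : Term (suc n) m) : Set where
  field
    values : ∀ x → σ x ≡ var (ρ x)
    others : ∀ {j} → j ≢ k₀ → τ j ≡ var (κ j)
    cont   : Q (suc n₁) m₁
    this   : τ k₀ ≡ ƛx cont
    cont⁻¹ : nfᴶ (cont ⁻¹Q) ≡ (κ k₀ , nf (ren (lift 1 ρ) κ R))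
open Redirects

module _ {σ : Fin n → W n₁ m₁} {τ : Fin m → K n₁ m₁} {ρ : Fin n → Fin n₁} {κ : Fin m → Fin m₁}
         {k₀ : Fin m} {R : Term (suc n) m} (r : Redirects σ τ ρ κ k₀ R) where

  redirects-lift : Redirects (var zero ∷ renW suc id ∘ σ) (renK suc id ∘ τ) (lift 1 ρ) κ k₀ (wk₁ R)
  redirects-lift .values zero    = refl
  redirects-lift .values (suc x) = cong (renW suc id) (r .values x)
  redirects-lift .others j≢k₀    = cong (renK suc id) (r .others j≢k₀)
  redirects-lift .cont           = renQ (lift 1 suc) id (r .cont)
  redirects-lift .this           = cong (renK suc id) (r .this)
  redirects-lift .cont⁻¹         = begin
    nfᴶ ((renQ (lift 1 suc) id (r .cont)) ⁻¹Q)
      ≡⟨ cong nfᴶ (⁻¹Q-ren (lift 1 suc) id (r .cont)) ⟩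
    nfᴶ (renᴶ (lift 1 suc) id ((r .cont) ⁻¹Q))
      ≡⟨ nfᴶ-ren (lift 1 suc) id ((r .cont) ⁻¹Q) ⟩
    (proj₁ (nfᴶ ((r .cont) ⁻¹Q)) , wk₁ (proj₂ (nfᴶ ((r .cont) ⁻¹Q))))
      ≡⟨ cong (λ (k , L) → k , wk₁ L) (r .cont⁻¹) ⟩
    (κ k₀ , wk₁ (nf (ren (lift 1 ρ) κ R)))
      ≡⟨ cong (κ k₀ ,_) (trans (sym (nf-ren (lift 1 suc) id (ren (lift 1 ρ) κ R)))
           (cong nf (sym (wk₁-ren ρ κ R)))) ⟩
    (κ k₀ , nf (ren (lift 1 (lift 1 ρ)) κ (wk₁ R))) ∎
    where open ≡-Reasoning

  redirects-liftᵏ : Redirects (renW id suc ∘ σ) (var zero ∷ renK id suc ∘ τ) ρ (lift 1 κ) (suc k₀) (wkᵏ R)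
  redirects-liftᵏ .values x = cong (renW id suc) (r .values x)
  redirects-liftᵏ .others {zero}  _    = refl
  redirects-liftᵏ .others {suc j} j≢k₀ = cong (renK id suc) (r .others (j≢k₀ ∘ cong suc))
  redirects-liftᵏ .cont   = renQ (lift 1 id) suc (r .cont)
  redirects-liftᵏ .this   = cong (renK id suc) (r .this)
  redirects-liftᵏ .cont⁻¹ = begin
    nfᴶ ((renQ (lift 1 id) suc (r .cont)) ⁻¹Q)
      ≡⟨ cong nfᴶ (⁻¹Q-ren (lift 1 id) suc (r .cont)) ⟩
    nfᴶ (renᴶ (lift 1 id) suc ((r .cont) ⁻¹Q))
      ≡⟨ nfᴶ-ren (lift 1 id) suc ((r .cont) ⁻¹Q) ⟩
    (suc (proj₁ (nfᴶ ((r .cont) ⁻¹Q))) , ren (lift 1 id) suc (proj₂ (nfᴶ ((r .cont) ⁻¹Q))))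
      ≡⟨ cong (λ (k , L) → suc k , ren (lift 1 id) suc L) (r .cont⁻¹) ⟩
    (suc (κ k₀) , ren (lift 1 id) suc (nf (ren (lift 1 ρ) κ R)))
      ≡⟨ cong (suc (κ k₀) ,_) (trans (sym (nf-ren (lift 1 id) suc (ren (lift 1 ρ) κ R)))
           (cong nf (ren-swap (λ x → lift-id (λ _ → refl) (lift 1 ρ x)) (λ _ → refl) R))) ⟩
    (suc (κ k₀) , nf (ren (lift 1 ρ) (lift 1 κ) (wkᵏ R))) ∎
    where open ≡-Reasoning

-- Substitution for `k₀` creates jumps `cont⁻¹ where x:=A`, redirection creates
-- `[κ k₀](R where x:=A)`; their canonical forms agree by `cont⁻¹`. Redirection precedes the
-- renaming, as β-μ precedes β-jmp, so `κ` may identify `k₀` with another label.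
⁻¹-redirect :
  {σ : Fin n → W n₁ m₁} {τ : Fin m → K n₁ m₁} {ρ : Fin n → Fin n₁} {κ : Fin m → Fin m₁}
  {k₀ : Fin m} {R : Term (suc n) m} → Redirects σ τ ρ κ k₀ R →
  ∀ t → nf ((subT σ τ t) ⁻¹) ≡ nf (ren ρ κ (redirect k₀ R (t ⁻¹)))
⁻¹Q-redirect :
  {σ : Fin n → W n₁ m₁} {τ : Fin m → K n₁ m₁} {ρ : Fin n → Fin n₁} {κ : Fin m → Fin m₁}
  {k₀ : Fin m} {R : Term (suc n) m} → Redirects σ τ ρ κ k₀ R →
  ∀ q → nfᴶ ((subQ σ τ q) ⁻¹Q) ≡ nfᴶ (renᴶ ρ κ (redirectᴶ k₀ R (q ⁻¹Q)))
⁻¹W-redirect :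
  {σ : Fin n → W n₁ m₁} {τ : Fin m → K n₁ m₁} {ρ : Fin n → Fin n₁} {κ : Fin m → Fin m₁}
  {k₀ : Fin m} {R : Term (suc n) m} → Redirects σ τ ρ κ k₀ R →
  ∀ w → nf ((subW σ τ w) ⁻¹W) ≡ nf (ren ρ κ (redirect k₀ R (w ⁻¹W)))
⁻¹K-redirect :
  {σ : Fin n → W n₁ m₁} {τ : Fin m → K n₁ m₁} {ρ : Fin n → Fin n₁} {κ : Fin m → Fin m₁}
  {k₀ : Fin m} {R : Term (suc n) m} → Redirects σ τ ρ κ k₀ R →
  ∀ c A {A′} → nf A′ ≡ nf (ren ρ κ (redirect k₀ R A)) →
  nfᴶ ((subK σ τ c) ⁻¹K[ A′ ]) ≡ nfᴶ (renᴶ ρ κ (redirectᴶ k₀ R (c ⁻¹K[ A ])))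
⁻¹-redirect r (ƛk q)   = cong muᴶ (⁻¹Q-redirect (redirects-liftᵏ r) q)
⁻¹-redirect r (v ·ᵂ w) = cong₂ _·_ (⁻¹W-redirect r v) (⁻¹W-redirect r w)
⁻¹Q-redirect r (c ·ᴷ w) = ⁻¹K-redirect r c (w ⁻¹W) (⁻¹W-redirect r w)
⁻¹Q-redirect r (t ·ᵀ c) = ⁻¹K-redirect r c (t ⁻¹) (⁻¹-redirect r t)
⁻¹W-redirect r (var x) rewrite r .values x = refl
⁻¹W-redirect r (ƛx t)  = cong ƛ_ (⁻¹-redirect (redirects-lift r) t)
⁻¹K-redirect {k₀ = k₀} r (var j) A h with j ≟ k₀
... | yes refl rewrite r .this = cong₂ whrᴶ (r .cont⁻¹) h
... | no j≢k₀  rewrite r .others j≢k₀ = cong (_ ,_) h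
⁻¹K-redirect r (ƛx q)  A h = cong₂ whrᴶ (⁻¹Q-redirect (redirects-lift r) q) h

-- Simulation of target reductions

⁻¹W-value : (w : W n m) → Value (nf (w ⁻¹W))
⁻¹W-value (var x) = var x
⁻¹W-value (ƛx t)  = ƛ _

body-nf : (J : Jump n m) → nf (body J) ≡ proj₂ (nfᴶ J)
body-nf ([ k ] M)    = refl
body-nf (J where≔ M) = cong (λ L → whr L (nf M)) (body-nf J)

nfᴶ-idempotent : (J : Jump n m) → nf (proj₂ (nfᴶ J)) ≡ proj₂ (nfᴶ J)
nfᴶ-idempotent J = trans (sym (⟶ᵛ*-nf (body-reduces J))) (body-nf J)

substitutes-/0 : (w : W n m) → Substitutes (w ∷ var) var (w ⁻¹W ∷ var)
substitutes-/0 w .values zero    = refl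
substitutes-/0 w .values (suc x) = refl
substitutes-/0 w .conts k        = refl

βx-⁻¹ : ∀ (q : Q (suc n) m) w →
        (proj₁ (nfᴶ (q ⁻¹Q)) , sub (nf (w ⁻¹W) ∷ var) (proj₂ (nfᴶ (q ⁻¹Q))))
        ≡ nfᴶ ((subQ (w ∷ var) var q) ⁻¹Q)
βx-⁻¹ q w = sym (trans
  (cong nfᴶ (⁻¹Q-sub (substitutes-/0 w) q))
  (nfᴶ-sub (λ { zero → ⁻¹W-value w ; (suc x) → var x }) (λ { zero → refl ; (suc x) → refl }) (q ⁻¹Q)))

β-⁻¹ : ∀ (t : T (suc n) m) w → sub (nf (w ⁻¹W) ∷ var) (nf (t ⁻¹)) ≡ nf ((subT (w ∷ var) var t) ⁻¹)
β-⁻¹ t w = sym (trans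
  (cong nf (⁻¹-sub (substitutes-/0 w) t))
  (nf-sub (λ { zero → ⁻¹W-value w ; (suc x) → var x }) (λ { zero → refl ; (suc x) → refl }) (t ⁻¹)))

plug-nf : ∀ (c : K n m) {A A′} → nf A ≡ nf A′ → nfᴶ (c ⁻¹K[ A ]) ≡ nfᴶ (c ⁻¹K[ A′ ])
plug-nf (var k) e = cong (k ,_) e
plug-nf (ƛx q)  e = cong (whrᴶ (nfᴶ (q ⁻¹Q))) e

plug-⇒ : ∀ (c : K n m) {A A′} → nf A ⟶* nf A′ → nfᴶ (c ⁻¹K[ A ]) ⇒ nfᴶ (c ⁻¹K[ A′ ])
plug-⇒ (var k) r = inner r
plug-⇒ (ƛx q)  r = inner (reduces-whr ε r)

βk-⇒* : ∀ (q : Q n (suc m)) c → nfᴶ (((ƛk q) ·ᵀ c) ⁻¹Q) ⇒* nfᴶ ((subQ var (c ∷ var) q) ⁻¹Q)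
βk-⇒* q (var l) = cut l (proj₁ (nfᴶ (q ⁻¹Q))) _ ◅ ≡-⇒* (sym (trans
  (cong (nfᴶ ∘ _⁻¹Q) (subQ-ren {ρ = id} {κ = l ∷ id}
    (record { values = λ _ → refl ; conts = λ { zero → refl ; (suc k) → refl } }) q))
  (trans (cong nfᴶ (⁻¹Q-ren id (l ∷ id) q)) (nfᴶ-ren id (l ∷ id) (q ⁻¹Q)))))
-- The redex reads `[l](L where x:=μk.J)`: β-μ distributes `L` to the jumps to `k`, and the cut then
-- replaces `k` by `l`.
βk-⇒* q (ƛx q₂) =
  inner (β-μ-nf L (q ⁻¹Q)) ◅ cut l (proj₁ (nfᴶ I)) _ ◅
  ≡-⇒* (sym (trans (⁻¹Q-redirect redirects q) (nfᴶ-ren id (l ∷ id) I)))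
  where
  l = proj₁ (nfᴶ (q₂ ⁻¹Q))
  L = proj₂ (nfᴶ (q₂ ⁻¹Q))
  I = redirectᴶ zero (wkᵏ L) (q ⁻¹Q)
  redirects : Redirects var (ƛx q₂ ∷ var) id (l ∷ id) zero (wkᵏ L)
  redirects .values x = refl
  redirects .others {zero}  0≢0 = contradiction refl 0≢0
  redirects .others {suc j} _   = refl
  redirects .cont = q₂
  redirects .this = refl
  redirects .cont⁻¹ = cong (l ,_) (sym (trans
    (cong nf (trans (ren-cong (lift-id (λ _ → refl)) (λ _ → refl) (wkᵏ L)) (cut-wkᵏ l L)))
    (nfᴶ-idempotent (q₂ ⁻¹Q))))

-- For a variable `c` this is η-let. For an abstraction the inner `where` binds to a variable, and
-- β-let removes it.
ηK-⇒* : ∀ (c : K n m) A → nfᴶ ((renK suc id c ·ᴷ var zero) ⁻¹Q where≔ A) ⇒* nfᴶ (c ⁻¹K[ A ])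
ηK-⇒* (var k) A = inner (reduces-≈ (≈-sym (whr-≈ (var zero) (nf A))) ◅◅ rule-⟶* η-let) ◅ ε
ηK-⇒* (ƛx q)  A = ⇒*-whrᴶ (nf A)
  (≡-⇒* (cong (λ J → whrᴶ J (var zero)) (trans (cong nfᴶ (⁻¹Q-ren (lift 1 suc) id q))
                                              (nfᴶ-ren (lift 1 suc) id (q ⁻¹Q))))
   ◅◅ inner (rule-⟶* (β-let (var zero)) ◅◅ ≡-⟶* (contract (proj₂ (nfᴶ (q ⁻¹Q))))) ◅ ε)
  where
  contract : ∀ L → sub (var zero ∷ var) (wk₁ L) ≡ L
  contract L = trans (sub-ren {σ = var} {ρ = id} (λ { zero → refl ; (suc x) → refl }) L)
    (trans (ren-id (λ _ → refl) (λ _ → refl) _) (sub-var (λ _ → refl) L))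

-- `η` on `T` is a vertical step and disappears in canonical forms. Steps on `K` are stated for
-- every filling `A`, because an inverse continuation is a jump with a hole.
⟶T-⟶* : {t t′ : T n m} → t ⟶T t′ → nf (t ⁻¹) ⟶* nf (t′ ⁻¹)
⟶Q-⇒* : {q q′ : Q n m} → q ⟶Q q′ → nfᴶ (q ⁻¹Q) ⇒* nfᴶ (q′ ⁻¹Q)
⟶W-⟶* : {w w′ : W n m} → w ⟶W w′ → nf (w ⁻¹W) ⟶* nf (w′ ⁻¹W)
⟶K-⇒* : {c c′ : K n m} → c ⟶K c′ → ∀ A → nfᴶ (c ⁻¹K[ A ]) ⇒* nfᴶ (c′ ⁻¹K[ A ])
⟶T-⟶* (β {t} {w}) = rule-⟶* (β-λ (⁻¹W-value w)) ◅◅ rule-⟶* (β-let (⁻¹W-value w)) ◅◅ ≡-⟶* (β-⁻¹ t w)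
⟶T-⟶* (η {t})     =
  ≡-⟶* (trans (cong (λ M → nf (μ [ zero ] M)) (⁻¹-ren id suc t)) (Vertical-nf (η-μ {M = t ⁻¹})))
⟶T-⟶* (ƛk s)      = ⇒*-muᴶ (⟶Q-⇒* s)
⟶T-⟶* (appˡ s)    = reduces-app (⟶W-⟶* s) ε
⟶T-⟶* (appʳ s)    = reduces-app ε (⟶W-⟶* s)
⟶Q-⇒* (βx {q} {w}) =
  inner (reduces-≈ (≈-sym (whr-≈ _ (nf (w ⁻¹W)))) ◅◅ rule-⟶* (β-let (⁻¹W-value w))) ◅ ≡-⇒* (βx-⁻¹ q w)
⟶Q-⇒* (βk {q} {c})      = βk-⇒* q c
⟶Q-⇒* (appKˡ {w = w} s) = ⟶K-⇒* s (w ⁻¹W)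
⟶Q-⇒* (appKʳ {c} s)     = plug-⇒ c (⟶W-⟶* s) ◅ ε
⟶Q-⇒* (appTˡ {c = c} s) = plug-⇒ c (⟶T-⟶* s) ◅ ε
⟶Q-⇒* (appTʳ {t} s)     = ⟶K-⇒* s (t ⁻¹)
⟶W-⟶* (η {w}) = ≡-⟶* (cong (λ V → ƛ (V · var zero))
                  (trans (cong nf (⁻¹W-ren suc id w)) (nf-ren suc id (w ⁻¹W))))
                ◅◅ rule-⟶* (η-λ (⁻¹W-value w))
⟶W-⟶* (ƛx s)  = reduces-gmap ƛ_ ƛ_ ƛ_ (⟶T-⟶* s)
⟶K-⇒* (η {c}) A = ηK-⇒* c A
⟶K-⇒* (ƛx s)  A = ⇒*-whrᴶ (nf A) (⟶Q-⇒* s)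

⟶βη*-⟶* : {t t′ : T n m} → t ⟶βη* t′ → nf (t ⁻¹) ⟶* nf (t′ ⁻¹)
⟶βη*-⟶* = Star.kleisliStar (λ t → nf (t ⁻¹)) ⟶T-⟶*

-- The CPS translation up to ad-expansion

-- The administrative content of the translation: every non-value operand is named by a `where`.
-- With two non-values, ad₁ goes first, so the function part is the outer `where`, matching the
-- nesting of continuations in `cps`.
ad  : Term n m → Term n m
adᴶ : Jump n m → Jump n m
ad (var x) = var x
ad (ƛ M)   = ƛ ad M
ad (M · N) with value? M | value? N
... | yes _ | yes _ = ad M · ad N
... | yes _ | no  _ = wk (ad M) · var zero where≔ ad N
... | no  _ | yes _ = var zero · wk (ad N) where≔ ad M
... | no  _ | no  _ = (var (suc zero) · var zero where≔ wk (ad N)) where≔ ad M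
ad (L where≔ M) = ad L where≔ ad M
ad (μ J)        = μ adᴶ J
adᴶ ([ k ] M)    = [ k ] ad M
adᴶ (J where≔ M) = adᴶ J where≔ ad M

ad-value : {V : Term n m} → Value V → Value (ad V)
ad-value (var x) = var x
ad-value (ƛ M)   = ƛ ad M

ad-nonvalue : (N : Term n m) → NonValue N → NonValue (ad N)
ad-nonvalue (var x)      nv _ = nv (var x)
ad-nonvalue (ƛ M)        nv _ = nv (ƛ M)
ad-nonvalue (M · N)      nv v with value? M | value? N
ad-nonvalue (M · N)      nv () | yes _ | yes _
ad-nonvalue (M · N)      nv () | yes _ | no  _
ad-nonvalue (M · N)      nv () | no  _ | yes _
ad-nonvalue (M · N)      nv () | no  _ | no  _

head-ad : (J : Jump n m) → proj₁ (nfᴶ (adᴶ J)) ≡ proj₁ (nfᴶ J)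
head-ad ([ k ] M)    = refl
head-ad (J where≔ M) = head-ad J

⟶*-ad      : (M : Term n m) → M ⟶* ad M
⟶*-body-ad : (J : Jump n m) → body J ⟶* body (adᴶ J)
⟶*-ad (var x) = ε
⟶*-ad (ƛ M)   = reduces-gmap ƛ_ ƛ_ ƛ_ (⟶*-ad M)
⟶*-ad (M · N) with value? M | value? N | reduces-app (⟶*-ad M) (⟶*-ad N)
... | yes _ | yes _ | r = r
... | yes v | no nw | r = r ◅◅ rule-⟶* (ad₂ (ad-value v) (ad-nonvalue N nw))
... | no nv | yes _ | r = r ◅◅ rule-⟶* (ad₁ (ad-nonvalue M nv))
... | no nv | no nw | r = r ◅◅ rule-⟶* (ad₁ (ad-nonvalue M nv)) ◅◅
  reduces-step (whereˡ (root (ad₂ (var zero) (ad-nonvalue N nw ∘ value-ren⁻ (ad N)))))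
⟶*-ad (L where≔ M) = reduces-where (⟶*-ad L) (⟶*-ad M)
⟶*-ad (μ J)        =
  reduces-≈ (Eq.gmap μ_ μ_ (≈ᴶ-body J)) ◅◅ reduces-jump _ (⟶*-body-ad J) ◅◅
  ≡-⟶* (cong (λ k → μ [ k ] body (adᴶ J)) (sym (head-ad J))) ◅◅
  reduces-≈ (≈-sym (Eq.gmap μ_ μ_ (≈ᴶ-body (adᴶ J))))
⟶*-body-ad ([ k ] M)    = ⟶*-ad M
⟶*-body-ad (J where≔ M) = reduces-where (⟶*-body-ad J) (⟶*-ad M)

-- A `where` crosses a continuation by (E3) if this is a variable and by (E1) if it is an
-- abstraction.
plug-where : ∀ (c : K n m) L M → nfᴶ ((renK suc id c) ⁻¹K[ L ] where≔ M) ≡ nfᴶ (c ⁻¹K[ L where≔ M ])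
plug-where (var k) L M = refl
plug-where (ƛx q)  L M = trans
  (cong (λ J → whrᴶ (whrᴶ J (nf L)) (nf M))
        (trans (cong nfᴶ (⁻¹Q-ren (lift 1 suc) id q)) (nfᴶ-ren (lift 1 suc) id (q ⁻¹Q))))
  (cong (_ ,_) (sym (whr-assoc _ (nf L) (nf M))))

-- The continuation `c` is arbitrary because `cps` turns the context of a subterm into its
-- continuation; `plug-where` turns it back into a context.
cps-nf : ∀ M (ρ : Fin n → Fin n₁) (κ : Fin m → Fin m₁) c →
         nfᴶ ((cps M ρ κ c) ⁻¹Q) ≡ nfᴶ (c ⁻¹K[ ren ρ κ (ad M) ])
cpsᴶ-nf : ∀ J (ρ : Fin n → Fin n₁) (κ : Fin m → Fin m₁) →
          nfᴶ ((cpsᴶ J ρ κ) ⁻¹Q) ≡ nfᴶ (renᴶ ρ κ (adᴶ J))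
star-nf : ∀ {V} (v : Value V) (ρ : Fin n → Fin n₁) (κ : Fin m → Fin m₁) →
          nf ((star V v ρ κ) ⁻¹W) ≡ nf (ren ρ κ (ad V))

star-nf-wk : ∀ {V} (v : Value V) (ρ : Fin n → Fin n₁) (κ : Fin m → Fin m₁) →
             nf ((star V v (suc ∘ ρ) κ) ⁻¹W) ≡ nf (ren (lift 1 ρ) κ (wk (ad V)))
star-nf-wk {V = V} v ρ κ = trans (star-nf v (suc ∘ ρ) κ)
  (cong nf (sym (ren-ren (λ _ → refl) (λ _ → refl) (ad V))))

cps-nf (var x) ρ κ c = refl
cps-nf (ƛ M)   ρ κ c = plug-nf c (star-nf (ƛ M) ρ κ)
cps-nf (M · N) ρ κ c with value? M | value? N
... | yes v | yes w = plug-nf c (cong₂ _·_ (star-nf v ρ κ) (star-nf w ρ κ))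
... | yes v | no  _ = begin
  nfᴶ ((cps N ρ κ _) ⁻¹Q)
    ≡⟨ cps-nf N ρ κ _ ⟩
  nfᴶ ((renK suc id c) ⁻¹K[ _ · var zero ] where≔ ren ρ κ (ad N))
    ≡⟨ plug-where c _ _ ⟩
  nfᴶ (c ⁻¹K[ _ · var zero where≔ ren ρ κ (ad N) ])
    ≡⟨ plug-nf c (cong (λ V → whr (V · var zero) (nf (ren ρ κ (ad N)))) (star-nf-wk v ρ κ)) ⟩
  nfᴶ (c ⁻¹K[ ren ρ κ (wk (ad M) · var zero where≔ ad N) ]) ∎
  where open ≡-Reasoning
... | no  _ | yes w = begin
  nfᴶ ((cps M ρ κ _) ⁻¹Q)
    ≡⟨ cps-nf M ρ κ _ ⟩
  nfᴶ ((renK suc id c) ⁻¹K[ var zero · _ ] where≔ ren ρ κ (ad M))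
    ≡⟨ plug-where c _ _ ⟩
  nfᴶ (c ⁻¹K[ var zero · _ where≔ ren ρ κ (ad M) ])
    ≡⟨ plug-nf c (cong (λ V → whr (var zero · V) (nf (ren ρ κ (ad M)))) (star-nf-wk w ρ κ)) ⟩
  nfᴶ (c ⁻¹K[ ren ρ κ (var zero · wk (ad N) where≔ ad M) ]) ∎
  where open ≡-Reasoning
... | no  _ | no  _ = begin
  nfᴶ ((cps M ρ κ _) ⁻¹Q)
    ≡⟨ cps-nf M ρ κ _ ⟩
  whrᴶ (nfᴶ ((cps N (suc ∘ ρ) κ _) ⁻¹Q)) x
    ≡⟨ cong (λ J → whrᴶ J x) (cps-nf N (suc ∘ ρ) κ _) ⟩
  whrᴶ (nfᴶ ((renK suc id (renK suc id c)) ⁻¹K[ app ] where≔ ren (suc ∘ ρ) κ (ad N))) x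
    ≡⟨ cong (λ J → whrᴶ J x) (plug-where (renK suc id c) app _) ⟩
  nfᴶ ((renK suc id c) ⁻¹K[ app where≔ ren (suc ∘ ρ) κ (ad N) ] where≔ ren ρ κ (ad M))
    ≡⟨ plug-where c _ _ ⟩
  nfᴶ (c ⁻¹K[ (app where≔ ren (suc ∘ ρ) κ (ad N)) where≔ ren ρ κ (ad M) ])
    ≡⟨ plug-nf c (cong (λ Y → whr (whr app (nf Y)) x)
                       (sym (ren-ren (λ _ → refl) (λ _ → refl) (ad N)))) ⟩
  nfᴶ (c ⁻¹K[ ren ρ κ ((var (suc zero) · var zero where≔ wk (ad N)) where≔ ad M) ]) ∎
  where
  open ≡-Reasoning
  x = nf (ren ρ κ (ad M))
  app = var (suc zero) · var zero
cps-nf (L where≔ M) ρ κ c = begin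
  nfᴶ ((cps M ρ κ _) ⁻¹Q)
    ≡⟨ cps-nf M ρ κ _ ⟩
  whrᴶ (nfᴶ ((cps L (lift 1 ρ) κ (renK suc id c)) ⁻¹Q)) (nf (ren ρ κ (ad M)))
    ≡⟨ cong (λ J → whrᴶ J _) (cps-nf L (lift 1 ρ) κ (renK suc id c)) ⟩
  nfᴶ ((renK suc id c) ⁻¹K[ ren (lift 1 ρ) κ (ad L) ] where≔ ren ρ κ (ad M))
    ≡⟨ plug-where c _ _ ⟩
  nfᴶ (c ⁻¹K[ ren ρ κ (ad L where≔ ad M) ]) ∎
  where open ≡-Reasoning
cps-nf (μ J) ρ κ c = plug-nf c (cong muᴶ (cpsᴶ-nf J ρ (lift 1 κ)))
cpsᴶ-nf ([ k ] M)    ρ κ = cps-nf M ρ κ (var (κ k))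
cpsᴶ-nf (J where≔ M) ρ κ = trans (cps-nf M ρ κ _)
  (cong (λ J → whrᴶ J (nf (ren ρ κ (ad M)))) (cpsᴶ-nf J (lift 1 ρ) κ))
star-nf (var x) ρ κ = refl
-- The translated abstraction comes back as `ƛ μ [ zero ] M` with the bound label fresh. Such
-- redexes, here and at the outer `ƛk_` of `⟦_⟧`, are the vertical ones that the translation
-- introduces.
star-nf (ƛ M)   ρ κ = cong ƛ_ (begin
  muᴶ (nfᴶ ((cps M (lift 1 ρ) (suc ∘ κ) (var zero)) ⁻¹Q))
    ≡⟨ cong muᴶ (cps-nf M (lift 1 ρ) (suc ∘ κ) (var zero)) ⟩
  nf (μ [ zero ] ren (lift 1 ρ) (suc ∘ κ) (ad M))
    ≡⟨ cong (λ M → nf (μ [ zero ] M)) (ren-ren (λ _ → refl) (λ _ → refl) (ad M)) ⟨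
  nf (μ [ zero ] wkᵏ (ren (lift 1 ρ) κ (ad M)))
    ≡⟨ Vertical-nf (η-μ {M = ren (lift 1 ρ) κ (ad M)}) ⟩
  nf (ren (lift 1 ρ) κ (ad M)) ∎)
  where open ≡-Reasoning

⟦⟧-nf : (M : Term n m) → nf (⟦ M ⟧ ⁻¹) ≡ nf (ad M)
⟦⟧-nf M = trans (cong muᴶ (cps-nf M id suc (var zero))) (Vertical-nf (η-μ {M = ad M}))

theorem1p34 : ∀ {n m : ℕ} (M M₀ : Term n m) (N : T n m) →
    M ≈ M₀ → ⟦ M₀ ⟧ ⟶βη* N →
    ∃[ P ] (P Is (N ⁻¹) ↓ × M ⟶* P)
theorem1p34 M M₀ N e r = nf (N ⁻¹) , nf-Is-↓ (N ⁻¹) ,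
  (reduces-≈ e ◅◅ ⟶*-ad M₀ ◅◅ nf-⟶* (ad M₀) ◅◅ ≡-⟶* (sym (⟦⟧-nf M₀)) ◅◅ ⟶βη*-⟶* r)
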